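{- In the abelian case associated with $\alpha_i\in\Pi$, the posets $(\mathrm{AN}(\Delta(1)),\le_{up})$ and $(\mathcal P(\varphi_i^\vee),\preccurlyeq)$ are naturally isomorphic; explicitly, the map $\Gamma_w\mapsto w(\varphi_i^\vee)$, $w\in W^0$, where $\Gamma_w=\min(\Delta(1)\setminus N(w))$, is an isomorphism.
   Context: Let $\mathfrak g$ be a complex simple Lie algebra with root system $\Delta$ in a real Euclidean space with $W$-invariant inner product $(\,,\,)$, positive roots $\Delta^+$, simple roots $\Pi=\{\alpha_1,\dots,\alpha_n\}$, Weyl group $W$, highest root $\theta$. For $\gamma\in\Delta$, $\gamma^\vee=2\gamma/(\gamma,\gamma)$; $\Delta^\vee=\{\gamma^\vee\}$ is the dual root system with simple roots $\Pi^\vee=\{\alpha^\vee:\alpha\in\Pi\}$. Abelian case: fix $\alpha_i\in\Pi$ whose coefficient in $\theta$ equals $1$; $\Delta(j)$ is the set of roots whose $\alpha_i$-coefficient is $j$, $\Delta(0)^+=\Delta(0)\cap\Delta^+$, and $\Delta(1)$ is partially ordered by $\mu\preccurlyeq\gamma$ iff $\gamma-\mu$ is a nonnegative integer combination of $\Pi\setminus\{\alpha_i\}$. $W^0=\{w\in W:w(\alpha)\in\Delta^+\ \forall\alpha\in\Delta(0)^+\}$, $N(w)=\{\gamma\in\Delta^+:w(\gamma)\in-\Delta^+\}$. $\varphi_i^\vee$ is the fundamental weight of $\Delta^\vee$ defined by $(\varphi_i^\vee,\alpha_j)=\delta_{ij}$ for all $j$ (it is minuscule). $\mathcal P(\varphi_i^\vee)$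 is the set of weights of the irreducible representation with highest weight $\varphi_i^\vee$ of the Lie algebra $\mathfrak g^\vee$ with root system $\Delta^\vee$ (equal to the orbit $W\varphi_i^\vee$), ordered by $\nu\preccurlyeq\mu$ iff $\mu-\nu$ is a nonnegative integer combination of $\Pi^\vee$. $\mathrm{AN}(\Delta(1))$ is the set of antichains of $\Delta(1)$, ordered by $\Gamma\le_{up}\Gamma'$ iff $I(\Gamma)\subset I(\Gamma')$, where $I(\Gamma)$ is the upper ideal generated by $\Gamma$. -}

module Defs where

open import Data.Nat using (ℕ; zero; suc) renaming (_<_ to _<ℕ_)
open import Data.Integer using (ℤ; +_; _+_; _-_; _*_; -_; _≤_; _<_; 0ℤ; 1ℤ)
open import Data.Fin using (Fin; zero; suc; _≟_)
open import Data.Vec using (Vec; lookup; tabulate; replicate)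
open import Data.List using (List)
open import Data.List.Membership.Propositional using (_∈_)
open import Data.List.Relation.Unary.Unique.Propositional using (Unique)
open import Data.List.Relation.Unary.All using (All)
open import Data.Product using (Σ; ∃; ∃-syntax; _×_; proj₁)
open import Data.Sum using (_⊎_)
open import Data.Bool using (Bool; true; false; if_then_else_)
open import Relation.Nullary using (¬_; does)
open import Relation.Binary.PropositionalEquality using (_≡_; _≢_)

-- Conventions.
-- A simple Lie algebra is given by its Cartan matrix C : Fin n → Fin n → ℤ,
--   C k m = 2 (α_k , α_m) / (α_k , α_k)  =  ⟨α_k^∨ , α_m⟩.
-- Elements of the root lattice are coordinate vectors w.r.t. Π
-- (Vec ℤ n, β = Σ_m β_m α_m).
-- Coweights (elements of the weight lattice of Δ^∨) are recorded by
-- their pairings with the simple roots: v ↦ ((v , α_m))_m.  Thus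
-- φ_i^∨ has coordinates δ_{im} and α_k^∨ has coordinates C k m.

Cartan : ℕ → Set
Cartan n = Fin n → Fin n → ℤ

sumF : ∀ {n} → (Fin n → ℤ) → ℤ
sumF {zero}  f = 0ℤ
sumF {suc n} f = f zero + sumF (λ j → f (suc j))

δ : ∀ {n} → Fin n → Fin n → ℤ
δ k m = if does (k ≟ m) then 1ℤ else 0ℤ

qform : ∀ {n} → Cartan n → (Fin n → ℕ) → Vec ℤ n → ℤ
qform C d x = sumF (λ k → sumF (λ m → lookup x k * lookup x m * ((+ d k) * C k m)))

-- C is the Cartan matrix of a (finite-dimensional) complex simple Lie algebra:
-- a symmetrisable generalised Cartan matrix whose symmetrisation is
-- positive definite (finite type) and which is indecomposable.
record IsSimpleCartan {n : ℕ} (C : Cartan n) : Set where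
  field
    diag     : ∀ k → C k k ≡ + 2
    offdiag  : ∀ k m → k ≢ m → C k m ≤ 0ℤ
    zeroSym  : ∀ k m → C k m ≡ 0ℤ → C m k ≡ 0ℤ
    d        : Fin n → ℕ
    d-pos    : ∀ k → 0 <ℕ d k
    symm     : ∀ k m → (+ d k) * C k m ≡ (+ d m) * C m k
    posdef   : ∀ (x : Vec ℤ n) → x ≢ replicate n 0ℤ → 0ℤ < qform C d x
    indec    : ∀ (S : Fin n → Bool) →
               (∀ k m → S k ≡ true → S m ≡ false → C k m ≡ 0ℤ) →
               (∀ k → S k ≡ true) ⊎ (∀ k → S k ≡ false)

module _ {n : ℕ} (C : Cartan n) where

  simple : Fin n → Vec ℤ n
  simple k = tabulate (δ k)

  pairCo : Vec ℤ n → Fin n → ℤ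
  pairCo β k = sumF (λ j → lookup β j * C k j)

  sRoot : Fin n → Vec ℤ n → Vec ℤ n
  sRoot k β = tabulate (λ m → lookup β m - pairCo β k * δ k m)

  sCo : Fin n → Vec ℤ n → Vec ℤ n
  sCo k v = tabulate (λ m → lookup v m - lookup v k * C k m)

  -- Weyl group elements as words s_{k1} ⋯ s_{kr}
  Word : Set
  Word = List (Fin n)

  actR : Word → Vec ℤ n → Vec ℤ n
  actR w β = Data.List.foldr sRoot β w

  actCo : Word → Vec ℤ n → Vec ℤ n
  actCo w v = Data.List.foldr sCo v w

  negV : Vec ℤ n → Vec ℤ n
  negV β = tabulate (λ m → - lookup β m)

  IsRoot : Vec ℤ n → Set
  IsRoot β = ∃[ w ] ∃[ j ] β ≡ actR w (simple j)

  IsPosRoot : Vec ℤ n → Set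
  IsPosRoot β = IsRoot β × (∀ m → 0ℤ ≤ lookup β m)

  IsHighestRoot : Vec ℤ n → Set
  IsHighestRoot θ = IsRoot θ × (∀ β → IsRoot β → ∀ m → lookup β m ≤ lookup θ m)

  InN : Word → Vec ℤ n → Set
  InN w γ = IsPosRoot γ × IsPosRoot (negV (actR w γ))

  module _ (i : Fin n) where

    Δ0pos : Vec ℤ n → Set
    Δ0pos β = IsPosRoot β × lookup β i ≡ 0ℤ

    Δ1 : Vec ℤ n → Set
    Δ1 β = IsRoot β × lookup β i ≡ 1ℤ

    -- μ ≼ γ on Δ(1): γ - μ is a ℕ-combination of Π ∖ {α_i}
    _≼_ : Vec ℤ n → Vec ℤ n → Set
    μ ≼ γ = (∀ m → lookup μ m ≤ lookup γ m) × lookup μ i ≡ lookup γ i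

    InW0 : Word → Set
    InW0 w = ∀ α → Δ0pos α → IsPosRoot (actR w α)

    IsAntichain : List (Vec ℤ n) → Set
    IsAntichain Γ = Unique Γ × All Δ1 Γ × (∀ x y → x ∈ Γ → y ∈ Γ → x ≼ y → x ≡ y)

    AN : Set
    AN = Σ (List (Vec ℤ n)) IsAntichain

    UpIdeal : AN → Vec ℤ n → Set
    UpIdeal Γ β = Δ1 β × ∃[ γ ] (γ ∈ proj₁ Γ × γ ≼ β)

    _≤up_ : AN → AN → Set
    Γ ≤up Γ' = ∀ β → UpIdeal Γ β → UpIdeal Γ' β

    SameSet : AN → AN → Set
    SameSet Γ Γ' = ∀ β → (β ∈ proj₁ Γ → β ∈ proj₁ Γ') × (β ∈ proj₁ Γ' → β ∈ proj₁ Γ)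

    IsΓ : Word → AN → Set
    IsΓ w Γ = ∀ β → (β ∈ proj₁ Γ →
                       (Δ1 β × ¬ InN w β) ×
                       (∀ μ → Δ1 μ → ¬ InN w μ → μ ≼ β → μ ≡ β))
                  × ((Δ1 β × ¬ InN w β) →
                       (∀ μ → Δ1 μ → ¬ InN w μ → μ ≼ β → μ ≡ β) → β ∈ proj₁ Γ)

    φ∨ : Vec ℤ n
    φ∨ = tabulate (δ i)

    P : Set
    P = Σ (Vec ℤ n) (λ v → ∃[ w ] v ≡ actCo w φ∨)

    _≼P_ : P → P → Set
    ν ≼P μ = Σ (Fin n → ℕ) (λ c → ∀ m → lookup (proj₁ μ) m - lookup (proj₁ ν) m
                                        ≡ sumF (λ k → (+ c k) * C k m))

    record IsOrderIso (f : AN → P) : Set where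
      field
        respects   : ∀ Γ Γ' → SameSet Γ Γ' → proj₁ (f Γ) ≡ proj₁ (f Γ')
        injective  : ∀ Γ Γ' → proj₁ (f Γ) ≡ proj₁ (f Γ') → SameSet Γ Γ'
        surjective : ∀ (v : P) → ∃[ Γ ] proj₁ (f Γ) ≡ proj₁ v
        monotone   : ∀ Γ Γ' → Γ ≤up Γ' → f Γ ≼P f Γ'
        reflecting : ∀ Γ Γ' → f Γ ≼P f Γ' → Γ ≤up Γ'

{-# OPTIONS --safe #-}
-- Roots are the lattice vectors with a certain length and divisibility property, which gives sign
-- coherence and decidability.  The map w ↦ N(w) ⊆ Δ(1) identifies W⁰ with the lower sets of Δ(1):
-- if w ∈ W⁰ and ⟨wφ , α_k⟩ = 1, then s_k w ∈ W⁰, N(s_k w) = N(w) ∪ {w⁻¹α_k} and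
-- s_k wφ = wφ - α_k^∨, and any lower set is filled by such steps.  Hence N(w′) ⊆ N(w) implies
-- wφ ≼ w′φ.  Conversely, if wφ ≺ w′φ, a step down from w′φ or a step up from wφ stays between the
-- two, because the coroot form is positive definite and weights have all coordinates in {-1, 0, 1}.
module Submission where

open import Defs
open import Data.Nat using (ℕ)
open import Data.Integer using (ℤ; 1ℤ)
open import Data.Fin using (Fin)
open import Data.Vec using (Vec; lookup)
open import Data.Product using (Σ; ∃-syntax; _×_; proj₁)
open import Relation.Binary.PropositionalEquality using (_≡_)
open import Data.Nat as ℕ using (zero; suc)
import Data.Nat.Properties as ℕₚ
open import Data.Integer hiding (suc; neg; _≟_)
open import Data.Integer.Properties hiding (_≟_)
import Data.Integer.Properties as ℤₚ
open import Data.Integer.Divisibility.Signed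
open import Data.Integer.Tactic.RingSolver using (solve-∀)
open import Data.Fin using (zero; suc; _≟_)
import Data.Fin.Properties as Finₚ
open import Data.List using (List; []; _∷_; _++_; reverse; length; map; upTo; filter;
  cartesianProductWith; deduplicate)
open import Data.List.Properties using (foldr-++; unfold-reverse; reverse-++; reverse-involutive)
open import Data.List.Membership.Propositional using (_∈_; find; lose)
open import Data.List.Membership.Propositional.Properties
  using (∈-map⁺; ∈-upTo⁺; ∈-cartesianProductWith⁺; ∈-filter⁺; ∈-filter⁻; ∈-deduplicate⁺)
open import Data.List.Relation.Unary.All as All using ()
open import Data.List.Relation.Unary.Any using (Any; here; there; any?)
import Data.List.Relation.Unary.Unique.Propositional.Properties as Uniqueₚ
import Data.List.Relation.Unary.Unique.DecPropositional.Properties as DecUniqueₚ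
open import Data.Vec using ([]; _∷_; tabulate)
open import Data.Vec.Properties using (lookup∘tabulate; tabulate∘lookup; tabulate-cong; lookup-replicate; ≡-dec)
open import Data.Product using (_,_; proj₂)
open import Data.Sum using (_⊎_; inj₁; inj₂; [_,_]′)
open import Function using (_∘_; id)
open import Relation.Nullary using (¬_; Dec; yes; no; contradiction)
open import Relation.Nullary.Decidable using (_×-dec_; map′; ¬?; decidable-stable)
open import Relation.Unary using (Decidable)
open import Relation.Binary.PropositionalEquality hiding (_≡_)

-- Integers and finite sums

-- The proof is effective, and this shapes it in three ways. `IsRoot` quantifies over all words, so
-- it cannot be tested as stated; the arithmetic description `Φ` turns it into a finite check, and
-- all roots of level 1 (the level being the coefficient of α_i) lie in the searchable box between 0
-- and θ. Words are not normal forms, so equality in W is equality of the actions on the root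
-- lattice; the key input is that a word whose inverse keeps all simple roots positive acts
-- trivially, which rests on an exchange argument. Finally, the map must start from an antichain: w
-- is built from Γ so that N(w) is the complement of I(Γ) in Δ(1). Complements reverse inclusion and
-- enlarging N(w) lowers wφ, so the two reversals cancel. The abelian hypothesis acts through ⟨wφ ,
-- α_k⟩, which equals the coefficient of α_i in w⁻¹α_k and hence is -1, 0 or 1: a simple reflection
-- moves a weight by at most one coroot.

*-nonneg : ∀ {a b} → 0ℤ ≤ a → 0ℤ ≤ b → 0ℤ ≤ a * b
*-nonneg {+ a} {+ b} _ _ = subst (0ℤ ≤_) (pos-* a b) (+≤+ ℕ.z≤n)

*-pos : ∀ {a b} → 0ℤ < a → 0ℤ < b → 0ℤ < a * b
*-pos {+[1+ a ]} {+[1+ b ]} _ _ = +<+ (ℕ.s≤s ℕ.z≤n)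
*-pos {+0} (+<+ ())
*-pos {+[1+ a ]} {+0} _ (+<+ ())

*-pos⁻¹ : ∀ {a b} → 0ℤ ≤ a → 0ℤ < a * b → 0ℤ < a × 0ℤ < b
*-pos⁻¹ {+0}     {b} _ p = contradiction (subst (0ℤ <_) (*-zeroˡ b) p) (i≮i)
*-pos⁻¹ {+[1+ a ]} {b} _ p =
  +<+ (ℕ.s≤s ℕ.z≤n) , *-cancelˡ-<-nonNeg +[1+ a ] (subst (_< +[1+ a ] * b) (sym (*-zeroʳ +[1+ a ])) p)

nonneg∧nonpos⇒0 : ∀ {a} → 0ℤ ≤ a → a ≤ 0ℤ → a ≡ 0ℤ
nonneg∧nonpos⇒0 p q = ≤-antisym q p

sumF-cong : ∀ {n} {f g : Fin n → ℤ} → (∀ k → f k ≡ g k) → sumF f ≡ sumF g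
sumF-cong {zero}  e = refl
sumF-cong {suc n} e = cong₂ _+_ (e zero) (sumF-cong (e ∘ suc))

sumF-0 : ∀ {n} → sumF {n} (λ _ → 0ℤ) ≡ 0ℤ
sumF-0 {zero}  = refl
sumF-0 {suc n} = trans (+-identityˡ _) (sumF-0 {n})

sumF-+ : ∀ {n} (f g : Fin n → ℤ) → sumF (λ k → f k + g k) ≡ sumF f + sumF g
sumF-+ {zero}  f g = refl
sumF-+ {suc n} f g = trans (cong (_+_ (f zero + g zero)) (sumF-+ (f ∘ suc) (g ∘ suc)))
                           (interchange (f zero) (g zero) _ _)
  where
  interchange : ∀ a b c d → a + b + (c + d) ≡ a + c + (b + d)
  interchange = solve-∀

sumF-* : ∀ {n} a (f : Fin n → ℤ) → sumF (λ k → a * f k) ≡ a * sumF f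
sumF-* {zero}  a f = sym (*-zeroʳ a)
sumF-* {suc n} a f = trans (cong (_+_ (a * f zero)) (sumF-* a (f ∘ suc))) (sym (*-distribˡ-+ a _ _))

sumF-sub : ∀ {n} a (f g : Fin n → ℤ) → sumF (λ k → f k - a * g k) ≡ sumF f - a * sumF g
sumF-sub a f g = begin
  sumF (λ k → f k - a * g k)         ≡⟨ sumF-cong (λ k → cong (_+_ (f k)) (neg-distribˡ-* a (g k))) ⟩
  sumF (λ k → f k + (- a) * g k)     ≡⟨ sumF-+ f (λ k → - a * g k) ⟩
  sumF f + sumF (λ k → - a * g k)    ≡⟨ cong (_+_ (sumF f)) (sumF-* (- a) g) ⟩
  sumF f + - a * sumF g              ≡⟨ cong (_+_ (sumF f)) (neg-distribˡ-* a (sumF g)) ⟨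
  sumF f - a * sumF g                ∎
  where open ≡-Reasoning

sumF-swap : ∀ {n m} (f : Fin n → Fin m → ℤ) →
            sumF (λ k → sumF (f k)) ≡ sumF (λ l → sumF (λ k → f k l))
sumF-swap {zero}  {m} f = sym (sumF-0 {m})
sumF-swap {suc n} {m} f = trans (cong (_+_ (sumF (f zero))) (sumF-swap (f ∘ suc)))
                            (sym (sumF-+ (f zero) (λ l → sumF (λ k → f (suc k) l))))

sumF-δ : ∀ {n} (f : Fin n → ℤ) k → sumF (λ j → f j * δ k j) ≡ f k
sumF-δ {suc n} f zero = begin
  f zero * 1ℤ + sumF (λ j → f (suc j) * 0ℤ)  ≡⟨ cong₂ _+_ (*-identityʳ (f zero)) (sumF-cong (λ j → *-zeroʳ (f (suc j)))) ⟩
  f zero + sumF (λ (j : Fin n) → 0ℤ)        ≡⟨ cong (_+_ (f zero)) (sumF-0 {n}) ⟩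
  f zero + 0ℤ                               ≡⟨ +-identityʳ (f zero) ⟩
  f zero                                    ∎
  where open ≡-Reasoning
sumF-δ {suc n} f (suc k) = begin
  f zero * 0ℤ + sumF (λ j → f (suc j) * δ k j) ≡⟨ cong₂ _+_ (*-zeroʳ (f zero)) (sumF-δ (f ∘ suc) k) ⟩
  0ℤ + f (suc k)                              ≡⟨ +-identityˡ (f (suc k)) ⟩
  f (suc k)                                   ∎
  where open ≡-Reasoning

sumF-nonneg : ∀ {n} {f : Fin n → ℤ} → (∀ k → 0ℤ ≤ f k) → 0ℤ ≤ sumF f
sumF-nonneg {zero}  p = ≤-refl
sumF-nonneg {suc n} p = +-mono-≤ (p zero) (sumF-nonneg (p ∘ suc))

sumF-nonpos : ∀ {n} {f : Fin n → ℤ} → (∀ k → f k ≤ 0ℤ) → sumF f ≤ 0ℤ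
sumF-nonpos {zero}  p = ≤-refl
sumF-nonpos {suc n} p = +-mono-≤ (p zero) (sumF-nonpos (p ∘ suc))

sumF-mono : ∀ {n} {f g : Fin n → ℤ} → (∀ k → f k ≤ g k) → sumF f ≤ sumF g
sumF-mono {zero}  p = ≤-refl
sumF-mono {suc n} p = +-mono-≤ (p zero) (sumF-mono (p ∘ suc))

sumF-mono-< : ∀ {n} {f g : Fin n → ℤ} → (∀ k → f k ≤ g k) → ∀ k → f k < g k → sumF f < sumF g
sumF-mono-< p zero    q = +-mono-<-≤ q (sumF-mono (p ∘ suc))
sumF-mono-< p (suc k) q = +-mono-≤-< (p zero) (sumF-mono-< (p ∘ suc) k q)

sumF-pos : ∀ {n} (f : Fin n → ℤ) → 0ℤ < sumF f → ∃[ k ] 0ℤ < f k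
sumF-pos {zero}  f p = contradiction p i≮i
sumF-pos {suc n} f p with 0ℤ <? f zero
... | yes q = zero , q
... | no ¬q = suc (proj₁ r) , proj₂ r
  where
  r = sumF-pos (f ∘ suc) (<-≤-trans p (subst (sumF f ≤_) (+-identityˡ _) (+-monoˡ-≤ _ (≮⇒≥ ¬q))))

sumF-∣ : ∀ {n} {d} {f : Fin n → ℤ} → (∀ k → d ∣ f k) → d ∣ sumF f
sumF-∣ {zero}  p = divides 0ℤ refl
sumF-∣ {suc n} p = ∣m∣n⇒∣m+n (p zero) (sumF-∣ (p ∘ suc))

-- The off-diagonal part of a symmetric double sum is twice its upper triangle.
symSum-∣ : ∀ {n} d (A : Fin n → Fin n → ℤ) → (∀ k l → A k l ≡ A l k) →
           (∀ k l → d ∣ A k l) → (∀ k → + 2 * d ∣ A k k) →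
           + 2 * d ∣ sumF (λ k → sumF (A k))
symSum-∣ {zero}  d A s p q = divides 0ℤ refl
symSum-∣ {suc n} d A s p q = subst (+ 2 * d ∣_) (sym eq)
  (∣m∣n⇒∣m+n (∣m∣n⇒∣m+n (q zero) (*-monoʳ-∣ (+ 2) (sumF-∣ (p zero ∘ suc))))
             (symSum-∣ d (λ k l → A (suc k) (suc l)) (λ _ _ → s _ _) (λ _ _ → p _ _) (q ∘ suc)))
  where
  open ≡-Reasoning
  row rest : ℤ
  row  = sumF (A zero ∘ suc)
  rest = sumF (λ k → sumF (A (suc k) ∘ suc))
  rearrange : ∀ a r t → a + r + (r + t) ≡ a + + 2 * r + t
  rearrange = solve-∀
  eq : sumF (λ k → sumF (A k)) ≡ A zero zero + + 2 * row + rest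
  eq = begin
    A zero zero + row + sumF (λ k → A (suc k) zero + sumF (A (suc k) ∘ suc))
      ≡⟨ cong (_+_ (A zero zero + row)) (sumF-+ (λ k → A (suc k) zero) (λ k → sumF (A (suc k) ∘ suc))) ⟩
    A zero zero + row + (sumF (λ k → A (suc k) zero) + rest)
      ≡⟨ cong (λ r → A zero zero + row + (r + rest)) (sumF-cong (λ k → s (suc k) zero)) ⟩
    A zero zero + row + (row + rest)
      ≡⟨ rearrange (A zero zero) row rest ⟩
    A zero zero + + 2 * row + rest ∎

δ-refl : ∀ {n} (k : Fin n) → δ k k ≡ 1ℤ
δ-refl zero    = refl
δ-refl (suc k) = δ-refl k

δ-≢ : ∀ {n} {k m : Fin n} → k ≢ m → δ k m ≡ 0ℤ
δ-≢ {k = zero}  {zero}  p = contradiction refl p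
δ-≢ {k = zero}  {suc m} p = refl
δ-≢ {k = suc k} {zero}  p = refl
δ-≢ {k = suc k} {suc m} p = δ-≢ {k = k} {m} (p ∘ cong suc)

δ-nonneg : ∀ {n} (k m : Fin n) → 0ℤ ≤ δ k m
δ-nonneg k m with k ≟ m
... | yes _ = +≤+ ℕ.z≤n
... | no _  = +≤+ ℕ.z≤n

vec-ext : ∀ {n} {x y : Vec ℤ n} → (∀ m → lookup x m ≡ lookup y m) → x ≡ y
vec-ext {x = x} {y} e = trans (sym (tabulate∘lookup x)) (trans (tabulate-cong e) (tabulate∘lookup y))

vec-≢ : ∀ {n} {x y : Vec ℤ n} → x ≢ y → ∃[ m ] lookup x m ≢ lookup y m
vec-≢ {n} {x} {y} x≢y with Finₚ.all? (λ m → lookup x m ℤₚ.≟ lookup y m)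
... | yes e = contradiction (vec-ext e) x≢y
... | no ¬e = Finₚ.¬∀⟶∃¬ n _ (λ m → lookup x m ℤₚ.≟ lookup y m) ¬e

-- Taking e_k = D / d_k clears the denominators of the coroots α_k^∨ = α_k / d_k.
commonMultiple : ∀ {n} (d : Fin n → ℕ) → (∀ k → 0 ℕ.< d k) →
  Σ (Fin n → ℤ) (λ e → ∃[ D ] ((∀ k → 0ℤ < e k) × 0ℤ < D × (∀ k → e k * + d k ≡ D)))
commonMultiple {zero}  d p = (λ ()) , 1ℤ , (λ ()) , +<+ (ℕ.s≤s ℕ.z≤n) , (λ ())
commonMultiple {suc n} d p with commonMultiple (d ∘ suc) (p ∘ suc)
... | e , D , e>0 , D>0 , eq = e′ , + d zero * D , e′>0 , *-pos (+<+ (p zero)) D>0 , eq′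
  where
  e′ : Fin (suc n) → ℤ
  e′ zero    = D
  e′ (suc k) = + d zero * e k
  e′>0 : ∀ k → 0ℤ < e′ k
  e′>0 zero    = D>0
  e′>0 (suc k) = *-pos (+<+ (p zero)) (e>0 k)
  eq′ : ∀ k → e′ k * + d k ≡ + d zero * D
  eq′ zero    = *-comm D (+ d zero)
  eq′ (suc k) = trans (*-assoc (+ d zero) (e k) _) (cong (_*_ (+ d zero)) (eq k))

positivePart negativePart : ℤ → ℤ
positivePart (+ n)    = + n
positivePart -[1+ n ] = 0ℤ
negativePart (+ n)    = 0ℤ
negativePart -[1+ n ] = +[1+ n ]

parts-diff : ∀ a → a ≡ positivePart a - 1ℤ * negativePart a
parts-diff (+ n)    = sym (+-identityʳ (+ n))
parts-diff -[1+ n ] = trans (cong -_ (sym (*-identityˡ +[1+ n ]))) (sym (+-identityˡ _))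

parts-disjoint : ∀ a → positivePart a * negativePart a ≡ 0ℤ
parts-disjoint (+ n)    = *-zeroʳ (+ n)
parts-disjoint -[1+ n ] = refl

positivePart-nonneg : ∀ a → 0ℤ ≤ positivePart a
positivePart-nonneg (+ n)    = +≤+ ℕ.z≤n
positivePart-nonneg -[1+ n ] = ≤-refl

negativePart-nonneg : ∀ a → 0ℤ ≤ negativePart a
negativePart-nonneg (+ n)    = ≤-refl
negativePart-nonneg -[1+ n ] = +≤+ ℕ.z≤n

positivePart-∣ : ∀ {d e} a → d ∣ a * e → d ∣ positivePart a * e
positivePart-∣ (+ n)    p = p
positivePart-∣ -[1+ n ] p = divides 0ℤ refl

negativePart-∣ : ∀ {d e} a → d ∣ a * e → d ∣ negativePart a * e
negativePart-∣ (+ n)    p = divides 0ℤ refl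
negativePart-∣ {e = e} -[1+ n ] p = subst (_ ∣_) (neg-distribˡ-* -[1+ n ] e) (∣m⇒∣-m p)

positivePart≢0 : ∀ {a} → 0ℤ < a → positivePart a ≢ 0ℤ
positivePart≢0 {+ n} p e = <⇒≢ p (sym e)

negativePart≢0 : ∀ {a} → a < 0ℤ → negativePart a ≢ 0ℤ
negativePart≢0 { -[1+ n ]} p ()
negativePart≢0 {+ n} (+<+ ())

<+suc⇒≤ : ∀ {a h} → a < +[1+ h ] → a ≤ + h
<+suc⇒≤ {+ n}      (+<+ (ℕ.s≤s p)) = +≤+ p
<+suc⇒≤ { -[1+ n ]} p              = -≤+

<+suc∣∣ : ∀ a → a < +[1+ ∣ a ∣ ]
<+suc∣∣ (+ n)    = +<+ (ℕₚ.n<1+n n)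
<+suc∣∣ -[1+ n ] = -<+

≤∧≢1⇒2≤ : ∀ {a} → 0ℤ < a → a ≢ 1ℤ → + 2 ≤ a
≤∧≢1⇒2≤ {+0}              (+<+ ()) q
≤∧≢1⇒2≤ {+[1+ zero ]}     p q = contradiction refl q
≤∧≢1⇒2≤ {+[1+ suc n ]}    p q = +≤+ (ℕ.s≤s (ℕ.s≤s ℕ.z≤n))

≤-multiple : ∀ {a b} → 0ℤ < a → 0ℤ < b → a ∣ b → a ≤ b
≤-multiple {a} {b} 0<a 0<b (divides q eq) = begin
  a       ≡⟨ *-identityʳ a ⟨
  a * 1ℤ  ≤⟨ *-monoˡ-≤-nonNeg a {{nonNegative (<⇒≤ 0<a)}} (i<j⇒suc[i]≤j 0<q) ⟩
  a * q   ≡⟨ trans (*-comm a q) (sym eq) ⟩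
  b       ∎
  where
  open ≤-Reasoning
  0<q : 0ℤ < q
  0<q = proj₂ (*-pos⁻¹ (<⇒≤ 0<a) (subst (0ℤ <_) (trans eq (*-comm q a)) 0<b))

i*j≡1⇒i≡1 : ∀ {i j} → 0ℤ ≤ i → i * j ≡ 1ℤ → i ≡ 1ℤ
i*j≡1⇒i≡1 {i} {j} 0≤i e =
  trans (sym (0≤i⇒+∣i∣≡i 0≤i))
        (cong +_ (ℕₚ.m*n≡1⇒m≡1 ∣ i ∣ ∣ j ∣ (trans (sym (abs-* i j)) (cong ∣_∣ e))))

module _ {n : ℕ} where

  NonNeg NonPos : Vec ℤ n → Set
  NonNeg x = ∀ m → 0ℤ ≤ lookup x m
  NonPos x = ∀ m → lookup x m ≤ 0ℤ

  lin : Vec ℤ n → ℤ → Vec ℤ n → Vec ℤ n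
  lin x a y = tabulate (λ m → lookup x m - a * lookup y m)

  lookup-lin : ∀ x a y m → lookup (lin x a y) m ≡ lookup x m - a * lookup y m
  lookup-lin x a y m = lookup∘tabulate _ m

  height : Vec ℤ n → ℤ
  height x = sumF (lookup x)

-- In use, a and b are half the squared lengths of a root β and of α_k, c and q are the Cartan
-- integers ⟨β , α_k^∨⟩ and ⟨α_k , β^∨⟩, and a - qa + b is half the squared length of β - α_k. If q
-- ≥ 2, then qa ≤ 2(qa - a) < 2b ≤ bc = qa.
quotient≡1 : ∀ {a b c q} → 0ℤ < a → 0ℤ ≤ b → 0ℤ < q → + 2 ≤ c → b * c ≡ q * a →
             0ℤ < a - q * a + b → q ≡ 1ℤ
quotient≡1 {a} {b} {c} {q} 0<a 0≤b 0<q 2≤c bc≡qa 0<rest =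
  decidable-stable (q ℤₚ.≟ 1ℤ) (λ q≢1 → <-irrefl refl (chain (≤∧≢1⇒2≤ 0<q q≢1)))
  where
  open ≤-Reasoning
  ring₁ : ∀ q a → q * a + (q - + 2) * a ≡ q * a - a + (q * a - a)
  ring₁ = solve-∀
  ring₂ : ∀ a b e → b - a + (a - b + e) ≡ e
  ring₂ = solve-∀
  ring₃ : ∀ a → a + a ≡ a * + 2
  ring₃ = solve-∀
  qa-a<b : q * a - a < b
  qa-a<b = subst₂ _<_ (+-identityʳ (q * a - a)) (ring₂ a (q * a) b) (+-monoʳ-< (q * a - a) 0<rest)
  chain : + 2 ≤ q → q * a < q * a
  chain 2≤q = begin-strict
    q * a                      ≡⟨ +-identityʳ (q * a) ⟨
    q * a + 0ℤ                 ≤⟨ +-monoʳ-≤ (q * a) (*-nonneg (i≤j⇒0≤j-i 2≤q) (<⇒≤ 0<a)) ⟩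
    q * a + (q - + 2) * a      ≡⟨ ring₁ q a ⟩
    q * a - a + (q * a - a)    <⟨ +-mono-< qa-a<b qa-a<b ⟩
    b + b                      ≡⟨ ring₃ b ⟩
    b * + 2                    ≤⟨ *-monoˡ-≤-nonNeg b {{nonNegative 0≤b}} 2≤c ⟩
    b * c                      ≡⟨ bc≡qa ⟩
    q * a                      ∎

between-±1 : ∀ {a} → -1ℤ ≤ a → a ≤ 1ℤ → a ≡ -1ℤ ⊎ a ≡ 0ℤ ⊎ a ≡ 1ℤ
between-±1 {+0}            _ _ = inj₂ (inj₁ refl)
between-±1 {+[1+ 0 ]}      _ _ = inj₂ (inj₂ refl)
between-±1 {+[1+ suc n ]}  _ (+≤+ (ℕ.s≤s ()))
between-±1 { -[1+ 0 ]}     _ _ = inj₁ refl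
between-±1 { -[1+ suc n ]} (-≤- ()) _

pos-∸-δ : ∀ {n} (c : Fin n → ℕ) m → 0 ℕ.< c m → ∀ k → + (c k ℕ.∸ ∣ δ m k ∣) ≡ + c k - δ m k
pos-∸-δ c m 0<c k with m ≟ k
... | no _     = sym (+-identityʳ (+ c k))
... | yes refl with c k | 0<c
...   | suc b | _ = refl

length-filter-≤ : ∀ {A : Set} {P Q : A → Set} (P? : Decidable P) (Q? : Decidable Q) →
                  (∀ {x} → P x → Q x) → ∀ xs → length (filter P? xs) ℕ.≤ length (filter Q? xs)
length-filter-≤ P? Q? P⊆Q []       = ℕ.z≤n
length-filter-≤ P? Q? P⊆Q (x ∷ xs) with P? x | Q? x
... | yes _ | yes _  = ℕ.s≤s (length-filter-≤ P? Q? P⊆Q xs)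
... | yes p | no ¬q  = contradiction (P⊆Q p) ¬q
... | no _  | yes _  = ℕₚ.m≤n⇒m≤1+n (length-filter-≤ P? Q? P⊆Q xs)
... | no _  | no _   = length-filter-≤ P? Q? P⊆Q xs

length-filter-< : ∀ {A : Set} {P Q : A → Set} (P? : Decidable P) (Q? : Decidable Q) →
                  (∀ {x} → P x → Q x) → ∀ {x xs} → x ∈ xs → ¬ P x → Q x →
                  length (filter P? xs) ℕ.< length (filter Q? xs)
length-filter-< P? Q? P⊆Q {x} {y ∷ xs} x∈ ¬p q with P? y | Q? y | x∈
... | yes p | _     | here refl = contradiction p ¬p
... | no _  | yes _ | here refl = ℕ.s≤s (length-filter-≤ P? Q? P⊆Q xs)
... | no _  | no ¬q | here refl = contradiction q ¬q
... | yes _ | yes _ | there x∈′ = ℕ.s≤s (length-filter-< P? Q? P⊆Q x∈′ ¬p q)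
... | yes p | no ¬q | there _   = contradiction (P⊆Q p) ¬q
... | no _  | yes _ | there x∈′ = ℕₚ.m≤n⇒m≤1+n (length-filter-< P? Q? P⊆Q x∈′ ¬p q)
... | no _  | no _  | there x∈′ = length-filter-< P? Q? P⊆Q x∈′ ¬p q

box : ∀ {n} → Vec ℤ n → List (Vec ℤ n)
box []      = [] ∷ []
box (t ∷ ts) = cartesianProductWith _∷_ (map +_ (upTo (suc ∣ t ∣))) (box ts)

∈-box : ∀ {n} (t x : Vec ℤ n) → (∀ m → 0ℤ ≤ lookup x m) → (∀ m → lookup x m ≤ lookup t m) → x ∈ box t
∈-box []       []      _ _ = here refl
∈-box (t ∷ ts) (x ∷ xs) p q = ∈-cartesianProductWith⁺ _∷_ (coord (p zero) (q zero)) (∈-box ts xs (p ∘ suc) (q ∘ suc))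
  where
  coord : ∀ {a b} → 0ℤ ≤ a → a ≤ b → a ∈ map +_ (upTo (suc ∣ b ∣))
  coord {+ a} {+ b} _ (+≤+ a≤b) = ∈-map⁺ +_ (∈-upTo⁺ (ℕ.s≤s a≤b))

-- Roots and the Weyl group

module RootSystem {n : ℕ} (C : Cartan n) (cartan : IsSimpleCartan C) where
  open IsSimpleCartan cartan

  α : Fin n → Vec ℤ n
  α = simple C

  s : Fin n → Vec ℤ n → Vec ℤ n
  s = sRoot C

  lookup-α : ∀ k m → lookup (α k) m ≡ δ k m
  lookup-α k m = lookup∘tabulate (δ k) m

  NonNeg-α : ∀ k → NonNeg (α k)
  NonNeg-α k m = subst (0ℤ ≤_) (sym (lookup-α k m)) (δ-nonneg k m)

  0<d : ∀ k → 0ℤ < + d k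
  0<d k = +<+ (d-pos k)

  d-nonZero : ∀ k → NonZero (+ d k)
  d-nonZero k = ≢-nonZero (≢-sym (<⇒≢ (0<d k)))

  -- The invariant form and the simple reflections

  pr : (Fin n → ℤ) → Fin n → ℤ
  pr y k = sumF (λ j → y j * C k j)

  -- The W-invariant form, normalised by (α_k , α_k) = 2 d_k. It takes coordinate functions, so that
  -- combinations such as p - q need not be made into vectors.
  B : (Fin n → ℤ) → (Fin n → ℤ) → ℤ
  B x y = sumF (λ k → x k * (+ d k * pr y k))

  pr-cong : ∀ {x y : Fin n → ℤ} → (∀ m → x m ≡ y m) → ∀ k → pr x k ≡ pr y k
  pr-cong e k = sumF-cong (λ j → cong (_* C k j) (e j))

  B-cong : ∀ {x x′ y y′} → (∀ m → x m ≡ x′ m) → (∀ m → y m ≡ y′ m) → B x y ≡ B x′ y′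
  B-cong e f = sumF-cong (λ k → cong₂ (λ a b → a * (+ d k * b)) (e k) (pr-cong f k))

  private
    distrib : ∀ x a y c → (x - a * y) * c ≡ x * c - a * (y * c)
    distrib = solve-∀

  pr-lin : ∀ x a y k → pr (λ m → x m - a * y m) k ≡ pr x k - a * pr y k
  pr-lin x a y k = trans (sumF-cong (λ j → distrib (x j) a (y j) (C k j)))
                          (sumF-sub {n} a (λ j → x j * C k j) (λ j → y j * C k j))

  B-linˡ : ∀ x a y z → B (λ m → x m - a * y m) z ≡ B x z - a * B y z
  B-linˡ x a y z = trans (sumF-cong (λ j → distrib (x j) a (y j) (+ d j * pr z j)))
                          (sumF-sub {n} a (λ j → x j * (+ d j * pr z j)) (λ j → y j * (+ d j * pr z j)))

  B-expand : ∀ x y → B x y ≡ sumF (λ k → sumF (λ m → x k * (+ d k * (y m * C k m))))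
  B-expand x y = sumF-cong (λ k →
    trans (cong (_*_ (x k)) (sym (sumF-* (+ d k) (λ m → y m * C k m))))
          (sym (sumF-* {n} (x k) (λ m → + d k * (y m * C k m)))))

  B-term-sym : ∀ (x y : Fin n → ℤ) k m → x k * (+ d k * (y m * C k m)) ≡ y m * (+ d m * (x k * C m k))
  B-term-sym x y k m = trans (l (x k) (+ d k) (y m) (C k m))
    (trans (cong (λ t → x k * (y m * t)) (symm k m)) (r (x k) (+ d m) (y m) (C m k)))
    where
    l : ∀ a b c e → a * (b * (c * e)) ≡ a * (c * (b * e))
    l = solve-∀
    r : ∀ a b c e → a * (c * (b * e)) ≡ c * (b * (a * e))
    r = solve-∀

  B-sym : ∀ x y → B x y ≡ B y x
  B-sym x y = begin
    B x y                                                         ≡⟨ B-expand x y ⟩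
    sumF (λ k → sumF (λ m → x k * (+ d k * (y m * C k m))))       ≡⟨ sumF-swap {n} {n} (λ k m → x k * (+ d k * (y m * C k m))) ⟩
    sumF (λ m → sumF (λ k → x k * (+ d k * (y m * C k m))))
      ≡⟨ sumF-cong (λ m → sumF-cong (λ k → B-term-sym x y k m)) ⟩
    sumF (λ m → sumF (λ k → y m * (+ d m * (x k * C m k))))       ≡⟨ B-expand y x ⟨
    B y x                                                         ∎
    where open ≡-Reasoning

  B-linʳ : ∀ x y a z → B x (λ m → y m - a * z m) ≡ B x y - a * B x z
  B-linʳ x y a z = trans (B-sym x (λ m → y m - a * z m)) (trans (B-linˡ y a z x)
    (cong₂ (λ s t → s - a * t) (B-sym y x) (B-sym z x)))

  B-lin² : ∀ x a y → B (λ m → x m - a * y m) (λ m → x m - a * y m)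
                   ≡ B x x - + 2 * (a * B y x) + a * a * B y y
  B-lin² x a y = begin
    B (λ m → x m - a * y m) (λ m → x m - a * y m)
      ≡⟨ B-linʳ (λ m → x m - a * y m) x a y ⟩
    B (λ m → x m - a * y m) x - a * B (λ m → x m - a * y m) y
      ≡⟨ cong₂ (λ s t → s - a * t) (B-linˡ x a y x) (B-linˡ x a y y) ⟩
    (B x x - a * B y x) - a * (B x y - a * B y y)
      ≡⟨ cong (λ t → (B x x - a * B y x) - a * (t - a * B y y)) (B-sym x y) ⟩
    (B x x - a * B y x) - a * (B y x - a * B y y)
      ≡⟨ ring (B x x) a (B y x) (B y y) ⟩
    B x x - + 2 * (a * B y x) + a * a * B y y ∎
    where
    open ≡-Reasoning
    ring : ∀ p a q r → (p - a * q) - a * (q - a * r) ≡ p - + 2 * (a * q) + a * a * r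
    ring = solve-∀

  B-δˡ : ∀ k y → B (δ k) y ≡ + d k * pr y k
  B-δˡ k y = trans (sumF-cong (λ m → *-comm (δ k m) _)) (sumF-δ (λ m → + d m * pr y m) k)

  pr-δ : ∀ k l → pr (δ k) l ≡ C l k
  pr-δ k l = trans (sumF-cong (λ m → *-comm (δ k m) _)) (sumF-δ (C l) k)

  B-αˡ : ∀ k y → B (lookup (α k)) y ≡ + d k * pr y k
  B-αˡ k y = trans (B-cong {lookup (α k)} {δ k} {y} {y} (lookup-α k) (λ _ → refl)) (B-δˡ k y)

  pr-α : ∀ k l → pr (lookup (α k)) l ≡ C l k
  pr-α k l = trans (pr-cong {lookup (α k)} {δ k} (lookup-α k) l) (pr-δ k l)

  B-αα : ∀ k → B (lookup (α k)) (lookup (α k)) ≡ + 2 * + d k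
  B-αα k = trans (B-αˡ k (lookup (α k))) (trans (cong (_*_ (+ d k)) (trans (pr-α k k) (diag k))) (*-comm (+ d k) (+ 2)))

  qform≡B : ∀ x → qform C d x ≡ B (lookup x) (lookup x)
  qform≡B x = trans (sumF-cong (λ k → sumF-cong (λ m → r (lookup x k) (lookup x m) (+ d k) (C k m))))
                    (sym (B-expand (lookup x) (lookup x)))
    where
    r : ∀ a b c e → a * b * (c * e) ≡ a * (c * (b * e))
    r = solve-∀

  B-posdef : ∀ y m → y m ≢ 0ℤ → 0ℤ < B y y
  B-posdef y m y≢0 = subst (0ℤ <_) (trans (qform≡B (tabulate y))
      (B-cong {lookup (tabulate y)} {y} {lookup (tabulate y)} {y} (lookup∘tabulate y) (lookup∘tabulate y)))
    (posdef (tabulate y) (λ e → y≢0 (trans (sym (lookup∘tabulate y m))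
      (trans (cong (λ v → lookup v m) e) (lookup-replicate m 0ℤ)))))

  s≡lin : ∀ k x → s k x ≡ lin x (pr (lookup x) k) (α k)
  s≡lin k x = tabulate-cong (λ m → cong (λ t → lookup x m - pr (lookup x) k * t) (sym (lookup-α k m)))

  lookup-s : ∀ k x m → lookup (s k x) m ≡ lookup x m - pr (lookup x) k * δ k m
  lookup-s k x m = lookup∘tabulate _ m

  lookup-s-≢ : ∀ k x m → k ≢ m → lookup (s k x) m ≡ lookup x m
  lookup-s-≢ k x m k≢m = trans (lookup-s k x m) (trans (cong (λ t → lookup x m - pr (lookup x) k * t) (δ-≢ k≢m))
    (trans (cong (λ t → lookup x m - t) (*-zeroʳ (pr (lookup x) k))) (+-identityʳ _)))

  pr-s : ∀ k x → pr (lookup (s k x)) k ≡ - pr (lookup x) k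
  pr-s k x = trans (pr-cong {lookup (s k x)} {λ m → lookup x m - p * δ k m} (lookup-s k x) k)
    (trans (pr-lin (lookup x) p (δ k) k)
    (trans (cong (λ t → p - p * t) (trans (pr-δ k k) (diag k))) (r p)))
    where
    p = pr (lookup x) k
    r : ∀ p → p - p * + 2 ≡ - p
    r = solve-∀

  s-involutive : ∀ k x → s k (s k x) ≡ x
  s-involutive k x = vec-ext (λ m → trans (lookup-s k (s k x) m)
    (trans (cong₂ (λ a b → a - b * δ k m) (lookup-s k x m) (pr-s k x)) (r (lookup x m) (pr (lookup x) k) (δ k m))))
    where
    r : ∀ a p e → (a - p * e) - (- p) * e ≡ a
    r = solve-∀

  B-s : ∀ k x y → B (lookup (s k x)) (lookup (s k y)) ≡ B (lookup x) (lookup y)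
  B-s k x y = begin
    B (lookup (s k x)) (lookup (s k y))
      ≡⟨ B-cong {lookup (s k x)} {x′} {lookup (s k y)} {y′} (lookup-s k x) (lookup-s k y) ⟩
    B x′ y′
      ≡⟨ B-linˡ (lookup x) p (δ k) y′ ⟩
    B (lookup x) y′ - p * B (δ k) y′
      ≡⟨ cong₂ (λ u v → u - p * v) (B-linʳ (lookup x) (lookup y) q (δ k)) (B-linʳ (δ k) (lookup y) q (δ k)) ⟩
    (B (lookup x) (lookup y) - q * B (lookup x) (δ k)) - p * (B (δ k) (lookup y) - q * B (δ k) (δ k))
      ≡⟨ cong₂ (λ u v → (B (lookup x) (lookup y) - q * u) - p * v)
           (trans (B-sym (lookup x) (δ k)) (B-δˡ k (lookup x)))
           (cong₂ (λ u v → u - q * v) (B-δˡ k (lookup y))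
             (trans (B-δˡ k (δ k)) (cong (_*_ (+ d k)) (trans (pr-δ k k) (diag k))))) ⟩
    (B (lookup x) (lookup y) - q * (+ d k * p)) - p * (+ d k * q - q * (+ d k * + 2))
      ≡⟨ r (B (lookup x) (lookup y)) p q (+ d k) ⟩
    B (lookup x) (lookup y) ∎
    where
    open ≡-Reasoning
    p q : ℤ
    p = pr (lookup x) k
    q = pr (lookup y) k
    x′ y′ : Fin n → ℤ
    x′ m = lookup x m - p * δ k m
    y′ m = lookup y m - q * δ k m
    r : ∀ b p q d → (b - q * (d * p)) - p * (d * q - q * (d * + 2)) ≡ b
    r = solve-∀

  -- A root of squared length 2 d_j is a vector x of that length with d_j ∣ d_m x_m for all m.
  -- The divisibility says that the coroot of x lies in the coroot lattice; it is W-invariant.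
  Integral : Fin n → (Fin n → ℤ) → Set
  Integral j x = ∀ m → + d j ∣ x m * + d m

  record Φ (j : Fin n) (x : Vec ℤ n) : Set where
    no-eta-equality
    pattern
    constructor _,_
    field
      integral : Integral j (lookup x)
      norm     : B (lookup x) (lookup x) ≡ + 2 * + d j

  -- By symmetry of the form, d_k ⟨x , α_k^∨⟩ = Σ x_m d_m C_mk, where each term is divisible by d_j.
  -- If x has squared length 2 d_j, the quotient is the other Cartan integer ⟨α_k , x^∨⟩.
  Integral-pr : ∀ {j x} → Integral j x → ∀ k → + d j ∣ + d k * pr x k
  Integral-pr {j} {x} int k = subst (+ d j ∣_) (sumF-* {n} (+ d k) (λ m → x m * C k m))
    (sumF-∣ (λ m → subst (+ d j ∣_) (eq m) (∣m⇒∣m*n (C m k) (int m))))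
    where
    l : ∀ a b c → a * b * c ≡ a * (b * c)
    l = solve-∀
    r : ∀ a b c → a * (b * c) ≡ b * (a * c)
    r = solve-∀
    eq : ∀ m → x m * + d m * C m k ≡ + d k * (x m * C k m)
    eq m = trans (l (x m) (+ d m) (C m k)) (trans (cong (_*_ (x m)) (symm m k)) (r (x m) (+ d k) (C k m)))

  Integral-sub : ∀ {j x a k} → Integral j x → + d j ∣ a * + d k → Integral j (λ m → x m - a * δ k m)
  Integral-sub {j} {x} {a} {k} int da m with k ≟ m
  ... | yes refl = subst (+ d j ∣_) (sym (distrib′ (x k) a (+ d k))) (∣m∣n⇒∣m-n (int k) da)
    where
    distrib′ : ∀ x a e → (x - a * 1ℤ) * e ≡ x * e - a * e
    distrib′ = solve-∀
  ... | no k≢m = subst (+ d j ∣_) (cong (_* + d m) (sym (r (x m) a))) (int m)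
    where
    r : ∀ x a → x - a * 0ℤ ≡ x
    r = solve-∀

  Integral-cong : ∀ {j x y} → (∀ m → x m ≡ y m) → Integral j x → Integral j y
  Integral-cong {j} e int m = subst (λ t → + d j ∣ t * + d m) (e m) (int m)

  -- In the double sum for (y , y) every term is a multiple of d_j; off-diagonal terms occur in
  -- equal pairs and diagonal ones carry the factor C k k = 2. So (y , y) is a positive multiple of
  -- 2 d_j.
  Integral-bound : ∀ {j y} → Integral j y → ∀ m → y m ≢ 0ℤ → + 2 * + d j ≤ B y y
  Integral-bound {j} {y} int m y≢0 =
    ≤-multiple (*-pos {+ 2} (+<+ (ℕ.s≤s ℕ.z≤n)) (0<d j)) (B-posdef y m y≢0)
      (subst (+ 2 * + d j ∣_) (sym (B-expand y y))
        (symSum-∣ (+ d j) (λ k l → y k * (+ d k * (y l * C k l))) (B-term-sym y y)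
          (λ k l → subst (+ d j ∣_) (*-assoc (y k) (+ d k) _) (∣m⇒∣m*n (y l * C k l) (int k)))
          (λ k → subst (+ 2 * + d j ∣_) (on-diag k) (∣n⇒∣m*n (y k) (*-monoʳ-∣ (+ 2) (int k))))))
    where
    r : ∀ a b → a * (+ 2 * (a * b)) ≡ a * (b * (a * + 2))
    r = solve-∀
    on-diag : ∀ k → y k * (+ 2 * (y k * + d k)) ≡ y k * (+ d k * (y k * C k k))
    on-diag k = trans (r (y k) (+ d k)) (cong (λ c → y k * (+ d k * (y k * c))) (sym (diag k)))

  -- Disjoint supports kill the diagonal terms, and the others carry off-diagonal Cartan entries,
  -- which are nonpositive.
  B-disjoint : ∀ p q → (∀ k → 0ℤ ≤ p k) → (∀ k → 0ℤ ≤ q k) → (∀ k → p k * q k ≡ 0ℤ) → B p q ≤ 0ℤ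
  B-disjoint p q 0≤p 0≤q pq≡0 =
    subst (_≤ 0ℤ) (sym (B-expand p q)) (sumF-nonpos (λ k → sumF-nonpos (λ m → term k m)))
    where
    r : ∀ a b c e → a * (b * (c * e)) ≡ a * c * (b * e)
    r = solve-∀
    r′ : ∀ a b c e → a * (b * (c * e)) ≡ a * (b * c) * e
    r′ = solve-∀
    term : ∀ k m → p k * (+ d k * (q m * C k m)) ≤ 0ℤ
    term k m with k ≟ m
    ... | yes refl = ≤-reflexive (trans (r (p k) (+ d k) (q k) (C k k)) (cong (_* (+ d k * C k k)) (pq≡0 k)))
    ... | no k≢m   = subst₂ _≤_ (sym (r′ (p k) (+ d k) (q m) (C k m))) (*-zeroʳ c)
                       (*-monoˡ-≤-nonNeg c {{nonNegative 0≤c}} (offdiag k m k≢m))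
      where
      c = p k * (+ d k * q m)
      0≤c : 0ℤ ≤ c
      0≤c = *-nonneg (0≤p k) (*-nonneg (<⇒≤ (0<d k)) (0≤q m))

  -- Write x = p - q with p, q ≥ 0 of disjoint support.  Then (p , q) ≤ 0, so if both were
  -- nonzero, (x , x) ≥ (p , p) + (q , q) ≥ 4 d_j.
  coherent : ∀ {j x} → Φ j x → NonNeg x ⊎ NonPos x
  coherent {j} {x} (int , norm) with Finₚ.all? (λ m → 0ℤ ≤? lookup x m)
  ... | yes nn = inj₁ nn
  ... | no ¬nn with Finₚ.¬∀⟶∃¬ n _ (λ m → 0ℤ ≤? lookup x m) ¬nn
  ... | m , xm≱0 = inj₂ (λ k → ≮⇒≥ (λ 0<xk → <⇒≱ (big k 0<xk) (≤-reflexive norm)))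
    where
    p q : Fin n → ℤ
    p = positivePart ∘ lookup x
    q = negativePart ∘ lookup x
    b = + 2 * + d j
    0<b : 0ℤ < b
    0<b = *-pos {+ 2} (+<+ (ℕ.s≤s ℕ.z≤n)) (0<d j)
    r : ∀ u v w → u - + 2 * (1ℤ * v) + 1ℤ * 1ℤ * w ≡ u + w + + 2 * (- v)
    r = solve-∀
    eq : B (lookup x) (lookup x) ≡ B p p + B q q + + 2 * (- B q p)
    eq = trans (B-cong {lookup x} {λ m → p m - 1ℤ * q m} {lookup x} {λ m → p m - 1ℤ * q m}
                       (parts-diff ∘ lookup x) (parts-diff ∘ lookup x))
               (trans (B-lin² p 1ℤ q) (r (B p p) (B q p) (B q q)))
    Bqp≤0 : B q p ≤ 0ℤ
    Bqp≤0 = B-disjoint q p (negativePart-nonneg ∘ lookup x) (positivePart-nonneg ∘ lookup x)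
              (λ k → trans (*-comm (q k) (p k)) (parts-disjoint (lookup x k)))
    big : ∀ k → 0ℤ < lookup x k → b < B (lookup x) (lookup x)
    big k 0<xk = begin-strict
      b                                ≡⟨ +-identityʳ b ⟨
      b + 0ℤ                           <⟨ +-monoʳ-< b 0<b ⟩
      b + b
        -- Divisibility is a condition on each coordinate, so p and q inherit it from x.
        ≤⟨ +-mono-≤ (Integral-bound {j} {p} (λ l → positivePart-∣ (lookup x l) (int l)) k (positivePart≢0 0<xk))
                    (Integral-bound {j} {q} (λ l → negativePart-∣ (lookup x l) (int l)) m
                                    (negativePart≢0 (≰⇒> xm≱0))) ⟩
      B p p + B q q                    ≡⟨ +-identityʳ _ ⟨
      B p p + B q q + 0ℤ               ≤⟨ +-monoʳ-≤ (B p p + B q q) (*-nonneg {+ 2} (+≤+ ℕ.z≤n) (neg-mono-≤ Bqp≤0)) ⟩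
      B p p + B q q + + 2 * (- B q p)  ≡⟨ eq ⟨
      B (lookup x) (lookup x)          ∎
      where open ≤-Reasoning

  _≟V_ : (x y : Vec ℤ n) → Dec (x ≡ y)
  _≟V_ = ≡-dec ℤₚ._≟_

  -- Negation and the action of words

  neg : Vec ℤ n → Vec ℤ n
  neg = negV C

  lookup-neg : ∀ x m → lookup (neg x) m ≡ - lookup x m
  lookup-neg x m = lookup∘tabulate _ m

  neg-involutive′ : ∀ x → neg (neg x) ≡ x
  neg-involutive′ x = vec-ext (λ m → trans (lookup-neg (neg x) m)
    (trans (cong -_ (lookup-neg x m)) (neg-involutive (lookup x m))))

  NonPos⇒NonNeg-neg : ∀ {x : Vec ℤ n} → NonPos x → NonNeg (neg x)
  NonPos⇒NonNeg-neg {x} np m = subst (0ℤ ≤_) (sym (lookup-neg x m)) (neg-mono-≤ (np m))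

  NonNeg-neg⇒NonPos : ∀ {x : Vec ℤ n} → NonNeg (neg x) → NonPos x
  NonNeg-neg⇒NonPos {x} nn m = neg-cancel-≤ (subst (0ℤ ≤_) (lookup-neg x m) (nn m))

  NonPos-neg-α : ∀ k → NonPos (neg (α k))
  NonPos-neg-α k = NonNeg-neg⇒NonPos {neg (α k)} (subst NonNeg (sym (neg-involutive′ (α k))) (NonNeg-α k))

  -- Writing -x as x - 2x makes negation an instance of `lin`, so that `act-lin` covers it.
  neg≡lin : ∀ x → neg x ≡ lin x (+ 2) x
  neg≡lin x = tabulate-cong (λ m → r (lookup x m))
    where
    r : ∀ a → - a ≡ a - + 2 * a
    r = solve-∀

  s-lin : ∀ k x a y → s k (lin x a y) ≡ lin (s k x) a (s k y)
  s-lin k x a y = vec-ext (λ m → begin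
    lookup (s k (lin x a y)) m
      ≡⟨ lookup-s k (lin x a y) m ⟩
    lookup (lin x a y) m - pr (lookup (lin x a y)) k * δ k m
      ≡⟨ cong₂ (λ u v → u - v * δ k m) (lookup-lin x a y m)
           (trans (pr-cong {lookup (lin x a y)} {λ l → lookup x l - a * lookup y l} (lookup-lin x a y) k)
                  (pr-lin (lookup x) a (lookup y) k)) ⟩
    (lookup x m - a * lookup y m) - (pr (lookup x) k - a * pr (lookup y) k) * δ k m
      ≡⟨ r (lookup x m) a (lookup y m) (pr (lookup x) k) (pr (lookup y) k) (δ k m) ⟩
    (lookup x m - pr (lookup x) k * δ k m) - a * (lookup y m - pr (lookup y) k * δ k m)
      ≡⟨ cong₂ (λ u v → u - a * v) (lookup-s k x m) (lookup-s k y m) ⟨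
    lookup (s k x) m - a * lookup (s k y) m
      ≡⟨ lookup-lin (s k x) a (s k y) m ⟨
    lookup (lin (s k x) a (s k y)) m ∎)
    where
    open ≡-Reasoning
    r : ∀ x a y p q e → (x - a * y) - (p - a * q) * e ≡ (x - p * e) - a * (y - q * e)
    r = solve-∀

  act : Word C → Vec ℤ n → Vec ℤ n
  act = actR C

  act-lin : ∀ w x a y → act w (lin x a y) ≡ lin (act w x) a (act w y)
  act-lin []      x a y = refl
  act-lin (k ∷ w) x a y = trans (cong (s k) (act-lin w x a y)) (s-lin k (act w x) a (act w y))

  act-neg : ∀ w x → act w (neg x) ≡ neg (act w x)
  act-neg w x = trans (cong (act w) (neg≡lin x)) (trans (act-lin w x (+ 2) x) (sym (neg≡lin (act w x))))

  act-++ : ∀ u w x → act (u ++ w) x ≡ act u (act w x)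
  act-++ u w x = foldr-++ s x u w

  act-reverse-∷ : ∀ k w x → act (reverse (k ∷ w)) x ≡ act (reverse w) (s k x)
  act-reverse-∷ k w x = trans (cong (λ u → act u x) (unfold-reverse k w)) (act-++ (reverse w) (k ∷ []) x)

  act-inverseˡ : ∀ w x → act (reverse w) (act w x) ≡ x
  act-inverseˡ []      x = refl
  act-inverseˡ (k ∷ w) x = trans (act-reverse-∷ k w (act (k ∷ w) x))
    (trans (cong (act (reverse w)) (s-involutive k (act w x))) (act-inverseˡ w x))

  act-inverseʳ : ∀ w x → act w (act (reverse w) x) ≡ x
  act-inverseʳ w x = trans (cong (λ u → act u (act (reverse w) x)) (sym (reverse-involutive w)))
                           (act-inverseˡ (reverse w) x)

  B-act : ∀ w x y → B (lookup (act w x)) (lookup (act w y)) ≡ B (lookup x) (lookup y)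
  B-act []      x y = refl
  B-act (k ∷ w) x y = trans (B-s k (act w x) (act w y)) (B-act w x y)

  s-α : ∀ k → s k (α k) ≡ neg (α k)
  s-α k = vec-ext (λ m → trans (lookup-s k (α k) m) (trans
    (cong₂ (λ u v → u - v * δ k m) (lookup-α k m) (trans (pr-α k k) (diag k)))
    (trans (r (δ k m)) (sym (trans (lookup-neg (α k) m) (cong -_ (lookup-α k m)))))))
    where
    r : ∀ e → e - + 2 * e ≡ - e
    r = solve-∀

  Φ-α : ∀ k → Φ k (α k)
  Φ-α k = (λ m → subst (λ t → + d k ∣ t * + d m) (sym (lookup-α k m)) (int m)) , B-αα k
    where
    int : ∀ m → + d k ∣ δ k m * + d m
    int m with k ≟ m
    ... | yes refl = divides 1ℤ refl
    ... | no _     = divides 0ℤ refl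

  Φ-s : ∀ {j x} k → Φ j x → Φ j (s k x)
  Φ-s {j} {x} k (int , norm) =
    Integral-cong {j} {λ m → lookup x m - pr (lookup x) k * δ k m} {lookup (s k x)} (λ m → sym (lookup-s k x m))
      (Integral-sub {j} {lookup x} {pr (lookup x) k} {k} int
        (subst (+ d j ∣_) (*-comm (+ d k) _) (Integral-pr {j} {lookup x} int k))) ,
    trans (B-s k x x) norm

  Φ-neg : ∀ {j x} → Φ j x → Φ j (neg x)
  Φ-neg {j} {x} (int , norm) =
    (λ m → subst (λ t → + d j ∣ t * + d m) (sym (lookup-neg x m))
       (subst (+ d j ∣_) (neg-distribˡ-* (lookup x m) (+ d m)) (∣m⇒∣-m (int m)))) ,
    trans (trans (cong (λ y → B (lookup y) (lookup y)) (neg≡lin x))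
          (trans (B-cong {lookup (lin x (+ 2) x)} {λ m → lookup x m - + 2 * lookup x m}
                         {lookup (lin x (+ 2) x)} {λ m → lookup x m - + 2 * lookup x m}
                         (lookup-lin x (+ 2) x) (lookup-lin x (+ 2) x))
          (trans (B-lin² (lookup x) (+ 2) (lookup x)) (r (B (lookup x) (lookup x)))))) norm
    where
    r : ∀ b → b - + 2 * (+ 2 * b) + + 2 * + 2 * b ≡ b
    r = solve-∀

  -- Roots: the orbit and its arithmetic description

  Root : Vec ℤ n → Set
  Root = IsRoot C

  Root-α : ∀ k → Root (α k)
  Root-α k = [] , k , refl

  Root-s : ∀ {x} k → Root x → Root (s k x)
  Root-s k (w , j , e) = k ∷ w , j , cong (s k) e

  Root-act : ∀ w {x} → Root x → Root (act w x)
  Root-act []      r = r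
  Root-act (k ∷ w) r = Root-s k (Root-act w r)

  Root-neg : ∀ {x} → Root x → Root (neg x)
  Root-neg (w , j , e) = w ++ j ∷ [] , j ,
    trans (cong neg e) (trans (sym (act-neg w (α j)))
      (trans (cong (act w) (sym (s-α j))) (sym (act-++ w (j ∷ []) (α j)))))

  Root⇒Φ : ∀ {x} → Root x → ∃[ j ] Φ j x
  Root⇒Φ (w , j , refl) = j , go w
    where
    go : ∀ w → Φ j (act w (α j))
    go []      = Φ-α j
    go (k ∷ w) = Φ-s k (go w)

  0<Φ-norm : ∀ {j x} → Φ j x → 0ℤ < B (lookup x) (lookup x)
  0<Φ-norm {j} (_ , norm) = subst (0ℤ <_) (sym norm) (*-pos {+ 2} (+<+ (ℕ.s≤s ℕ.z≤n)) (0<d j))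

  Φ-not-both : ∀ {j x} → Φ j x → NonNeg x → ¬ NonPos x
  Φ-not-both {j} {x} φ nn np = <⇒≢ (0<Φ-norm φ)
    (sym (trans (sumF-cong {n} (λ k → cong (_* (+ d k * pr (lookup x) k)) (nonneg∧nonpos⇒0 (nn k) (np k)))) (sumF-0 {n})))

  -- The sum Σ x_k d_k ⟨x , α_k^∨⟩ is (x , x) > 0, so one of its terms is positive.
  Φ-ascent : ∀ {j x} → Φ j x → NonNeg x → ∃[ k ] (0ℤ < lookup x k × 0ℤ < pr (lookup x) k)
  Φ-ascent {j} {x} φ nn with sumF-pos {n} (λ k → lookup x k * (+ d k * pr (lookup x) k)) (0<Φ-norm φ)
  ... | k , p = k , proj₁ q , proj₂ (*-pos⁻¹ (<⇒≤ (0<d k)) (proj₂ q))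
    where q = *-pos⁻¹ (nn k) p

  -- If t α_k has squared length 2 d_j, where d_j ∣ t d_k, then t² d_k = d_j ∣ t d_k.
  Φ-multiple : ∀ {j x} k → Φ j x → NonNeg x → (∀ m → k ≢ m → lookup x m ≡ 0ℤ) → x ≡ α k
  Φ-multiple {j} {x} k (int , norm) nn off = vec-ext (λ m →
    trans (x-mult m) (trans (cong (_* δ k m) t≡1) (trans (*-identityˡ (δ k m)) (sym (lookup-α k m)))))
    where
    t : ℤ
    t = lookup x k
    x-mult : ∀ m → lookup x m ≡ t * δ k m
    x-mult m with k ≟ m
    ... | yes refl = sym (*-identityʳ t)
    ... | no k≢m   = trans (off m k≢m) (sym (*-zeroʳ t))
    pr-x : ∀ l → pr (lookup x) l ≡ t * C l k
    pr-x l = trans (sumF-cong {n} (λ m → trans (cong (_* C l m) (x-mult m)) (r t (δ k m) (C l m))))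
                   (trans (sumF-* {n} t (λ m → C l m * δ k m)) (cong (_*_ t) (sumF-δ (C l) k)))
      where
      r : ∀ t e c → t * e * c ≡ t * (c * e)
      r = solve-∀
    B-x : B (lookup x) (lookup x) ≡ + 2 * (t * (t * + d k))
    B-x = begin
      sumF (λ m → lookup x m * (+ d m * pr (lookup x) m))
        ≡⟨ sumF-cong {n} (λ m → trans (cong (_* (+ d m * pr (lookup x) m)) (x-mult m))
                                      (r t (δ k m) (+ d m * pr (lookup x) m))) ⟩
      sumF (λ m → t * (+ d m * pr (lookup x) m) * δ k m)
        ≡⟨ sumF-δ (λ m → t * (+ d m * pr (lookup x) m)) k ⟩
      t * (+ d k * pr (lookup x) k)
        ≡⟨ cong (λ p → t * (+ d k * p)) (trans (pr-x k) (cong (_*_ t) (diag k))) ⟩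
      t * (+ d k * (t * + 2))
        ≡⟨ r′ t (+ d k) ⟩
      + 2 * (t * (t * + d k)) ∎
      where
      open ≡-Reasoning
      r : ∀ t e c → t * e * c ≡ t * c * e
      r = solve-∀
      r′ : ∀ t e → t * (e * (t * + 2)) ≡ + 2 * (t * (t * e))
      r′ = solve-∀
    t≡1 : t ≡ 1ℤ
    t≡1 with int k
    ... | divides e eq = i*j≡1⇒i≡1 {t} {e} (nn k)
      (*-cancelʳ-≡ (t * e) 1ℤ (+ d j) {{d-nonZero j}} (trans (*-assoc t e (+ d j))
        (trans (cong (_*_ t) (sym eq)) (trans (*-cancelˡ-≡ (+ 2) (t * (t * + d k)) (+ d j) (trans (sym B-x) norm))
               (sym (*-identityˡ (+ d j)))))))

  -- s_k changes only the k-th coordinate. If the sign of x flips, all other coordinates are both ≥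
  -- 0 and ≤ 0, and x is a multiple of α_k.
  Φ-s-NonNeg : ∀ {j x} k → Φ j x → NonNeg x → x ≡ α k ⊎ NonNeg (s k x)
  Φ-s-NonNeg {j} {x} k φ nn with coherent {j} {s k x} (Φ-s k φ)
  ... | inj₁ nn′ = inj₂ nn′
  ... | inj₂ np  = inj₁ (Φ-multiple k φ nn (λ m k≢m →
    nonneg∧nonpos⇒0 (nn m) (subst (_≤ 0ℤ) (lookup-s-≢ k x m k≢m) (np m))))

  height-s : ∀ k x → height (s k x) ≡ height x - pr (lookup x) k
  height-s k x = trans (sumF-cong {n} (lookup-s k x)) (trans (sumF-sub {n} (pr (lookup x) k) (lookup x) (δ k))
    (trans (cong (λ t → height x - pr (lookup x) k * t)
      (trans (sumF-cong {n} (λ m → sym (*-identityˡ (δ k m)))) (sumF-δ (λ _ → 1ℤ) k)))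
      (cong (λ t → height x - t) (*-identityʳ (pr (lookup x) k)))))

  sub-pos-< : ∀ a {b} → 0ℤ < b → a - b < a
  sub-pos-< a {b} 0<b = subst (a - b <_) (+-identityʳ a) (+-monoʳ-< a (neg-mono-< 0<b))

  -- Descent on the height, bounded by h: the reflection found by `Φ-ascent` lowers it and keeps x
  -- nonnegative, unless x is already simple.
  Φ⇒Root⁺ : ∀ {j} h x → Φ j x → NonNeg x → height x < + h → Root x
  Φ⇒Root⁺ zero x φ nn hx = contradiction (sumF-nonneg nn) (<⇒≱ hx)
  Φ⇒Root⁺ {j} (suc h) x φ nn hx with Φ-ascent φ nn
  ... | k , _ , 0<p with Φ-s-NonNeg k φ nn
  ... | inj₁ refl = Root-α k
  ... | inj₂ nn′  = subst Root (s-involutive k x) (Root-s k (Φ⇒Root⁺ {j} h (s k x) (Φ-s k φ) nn′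
    (<-≤-trans (subst (_< height x) (sym (height-s k x)) (sub-pos-< (height x) 0<p)) (<+suc⇒≤ hx))))

  Φ⇒Root : ∀ {j x} → Φ j x → Root x
  Φ⇒Root {j} {x} φ with coherent {j} {x} φ
  ... | inj₁ nn = Φ⇒Root⁺ {j} (suc ∣ height x ∣) x φ nn (<+suc∣∣ (height x))
  ... | inj₂ np = subst Root (neg-involutive′ x) (Root-neg
    (Φ⇒Root⁺ {j} (suc ∣ height (neg x) ∣) (neg x) (Φ-neg {j} {x} φ) (NonPos⇒NonNeg-neg {x} np) (<+suc∣∣ (height (neg x)))))

  Root? : ∀ x → Dec (Root x)
  Root? x = map′ to from (Finₚ.any? (λ j →
    Finₚ.all? (λ m → + d j ∣? lookup x m * + d m) ×-dec (B (lookup x) (lookup x) ℤₚ.≟ + 2 * + d j)))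
    where
    to : ∃[ j ] (Integral j (lookup x) × B (lookup x) (lookup x) ≡ + 2 * + d j) → Root x
    to (j , int , norm) = Φ⇒Root {j} (int , norm)
    from : Root x → ∃[ j ] (Integral j (lookup x) × B (lookup x) (lookup x) ≡ + 2 * + d j)
    from r with Root⇒Φ r
    ... | j , (int , norm) = j , int , norm

  Root-coherent : ∀ {x} → Root x → NonNeg x ⊎ NonPos x
  Root-coherent r = coherent (proj₂ (Root⇒Φ r))

  Root-not-both : ∀ {x} → Root x → NonNeg x → ¬ NonPos x
  Root-not-both r = Φ-not-both (proj₂ (Root⇒Φ r))

  Root-s-NonNeg : ∀ {x} k → Root x → NonNeg x → x ≡ α k ⊎ NonNeg (s k x)
  Root-s-NonNeg k r = Φ-s-NonNeg k (proj₂ (Root⇒Φ r))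

  Root-s-NonPos : ∀ {x} k → Root x → NonPos x → x ≡ neg (α k) ⊎ NonPos (s k x)
  Root-s-NonPos {x} k r np = [ inj₁ ∘ negated , inj₂ ∘ reflected ]′
    (Root-s-NonNeg {neg x} k (Root-neg r) (NonPos⇒NonNeg-neg {x} np))
    where
    negated : neg x ≡ α k → x ≡ neg (α k)
    negated e = trans (sym (neg-involutive′ x)) (cong neg e)
    reflected : NonNeg (s k (neg x)) → NonPos (s k x)
    reflected nn = NonNeg-neg⇒NonPos {s k x} (subst NonNeg (act-neg (k ∷ []) x) nn)

  -- With c = ⟨β , α_k^∨⟩, either c = 1 and β - α_k = s_k β, or d_j = c d_k and β - α_k is as short as α_k.
  Root-sub-α : ∀ {β} k → Root β → 0ℤ < pr (lookup β) k → β ≢ α k → Root (lin β 1ℤ (α k))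
  Root-sub-α {β} k r 0<c β≢α with Root⇒Φ r | pr (lookup β) k ℤₚ.≟ 1ℤ
  ... | j , φ | yes c≡1 = subst Root (trans (s≡lin k β) (cong (λ c → lin β c (α k)) c≡1)) (Root-s k r)
  ... | j , (int , norm) | no c≢1 = Φ⇒Root {k} (int′ , norm′)
    where
    c q : ℤ
    c = pr (lookup β) k
    dj dk : ℤ
    dj = + d j
    dk = + d k
    div : dj ∣ dk * c
    div = Integral-pr {j} {lookup β} int k
    -- q is the Cartan integer ⟨α_k , β^∨⟩; positivity of the squared length of β - α_k will force q
    -- = 1.
    q = quotient div
    q-eq : dk * c ≡ q * dj
    q-eq = _∣_.equality div
    y : Vec ℤ n
    y = lin β 1ℤ (α k)
    differs : ∃[ m ] lookup β m ≢ lookup (α k) m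
    differs = vec-≢ β≢α
    y≢0 : lookup y (proj₁ differs) ≢ 0ℤ
    y≢0 e = proj₂ differs (i-j≡0⇒i≡j _ _ (trans (cong (λ t → lookup β m - t) (sym (*-identityˡ (lookup (α k) m))))
                                                (trans (sym (lookup-lin β 1ℤ (α k) m)) e)))
      where
      m : Fin n
      m = proj₁ differs
    norm-y : B (lookup y) (lookup y) ≡ + 2 * (dj - q * dj + dk)
    norm-y = begin
      B (lookup y) (lookup y)
        ≡⟨ B-cong {lookup y} {y′} {lookup y} {y′} (lookup-lin β 1ℤ (α k)) (lookup-lin β 1ℤ (α k)) ⟩
      B y′ y′
        ≡⟨ B-lin² (lookup β) 1ℤ (lookup (α k)) ⟩
      B (lookup β) (lookup β) - + 2 * (1ℤ * B (lookup (α k)) (lookup β)) + 1ℤ * 1ℤ * B (lookup (α k)) (lookup (α k))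
        ≡⟨ cong₂ (λ u v → u + 1ℤ * 1ℤ * v)
             (cong₂ (λ u v → u - + 2 * (1ℤ * v)) norm (trans (B-αˡ k (lookup β)) q-eq)) (B-αα k) ⟩
      + 2 * dj - + 2 * (1ℤ * (q * dj)) + 1ℤ * 1ℤ * (+ 2 * dk)
        ≡⟨ ring dj (q * dj) dk ⟩
      + 2 * (dj - q * dj + dk) ∎
      where
      open ≡-Reasoning
      y′ : Fin n → ℤ
      y′ m = lookup β m - 1ℤ * lookup (α k) m
      ring : ∀ a b e → + 2 * a - + 2 * (1ℤ * b) + 1ℤ * 1ℤ * (+ 2 * e) ≡ + 2 * (a - b + e)
      ring = solve-∀
    0<rest : 0ℤ < dj - q * dj + dk
    0<rest = proj₂ (*-pos⁻¹ {+ 2} (+≤+ ℕ.z≤n)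
      (subst (0ℤ <_) norm-y (B-posdef (lookup y) (proj₁ differs) y≢0)))
    0<q : 0ℤ < q
    0<q = proj₂ (*-pos⁻¹ {dj} (<⇒≤ (0<d j))
      (subst (0ℤ <_) (trans q-eq (*-comm q dj)) (*-pos (0<d k) 0<c)))
    q≡1 : q ≡ 1ℤ
    q≡1 = quotient≡1 (0<d j) (<⇒≤ (0<d k)) 0<q (≤∧≢1⇒2≤ 0<c c≢1) q-eq 0<rest
    norm′ : B (lookup y) (lookup y) ≡ + 2 * dk
    norm′ = trans norm-y (cong (_*_ (+ 2)) (trans (cong (λ q → dj - q * dj + dk) q≡1) (ring dj dk)))
      where
      ring : ∀ a b → a - 1ℤ * a + b ≡ b
      ring = solve-∀
    -- With q = 1 the relation reads d_j = c d_k, so divisibility by d_j passes to d_k.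
    dk∣dj : dk ∣ dj
    dk∣dj = divides c (trans (sym (*-identityˡ dj)) (trans (cong (_* dj) (sym q≡1)) (trans (sym q-eq) (*-comm dk c))))
    int′ : Integral k (lookup y)
    int′ = Integral-cong {k} {λ m → lookup β m - 1ℤ * δ k m} {lookup y}
      (λ m → sym (trans (lookup-lin β 1ℤ (α k) m) (cong (λ t → lookup β m - 1ℤ * t) (lookup-α k m))))
      (Integral-sub {k} {lookup β} {1ℤ} {k} (λ m → ∣-trans dk∣dj (int m)) (∣n⇒∣m*n 1ℤ ∣-refl))

  -- Equality of actions and the exchange argument

  infix 4 _≈_
  _≈_ : Word C → Word C → Set
  u ≈ w = ∀ x → act u x ≡ act w x

  ≈-reverse : ∀ {u w} → u ≈ w → reverse u ≈ reverse w
  ≈-reverse {u} {w} e x = begin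
    act (reverse u) x                                ≡⟨ cong (act (reverse u)) (act-inverseʳ w x) ⟨
    act (reverse u) (act w (act (reverse w) x))      ≡⟨ cong (act (reverse u)) (e (act (reverse w) x)) ⟨
    act (reverse u) (act u (act (reverse w) x))      ≡⟨ act-inverseˡ u _ ⟩
    act (reverse w) x                                ∎
    where open ≡-Reasoning

  -- Since a preserves the form, α_k and α_t have equal length, and a carries the pairing with α_k^∨
  -- to that with α_t^∨. This is a s_k a⁻¹ = s_t.
  act-conj : ∀ a k t → act a (α k) ≡ α t → ∀ y → s t (act a y) ≡ act a (s k y)
  act-conj a k t e y = begin
    s t (act a y)                                  ≡⟨ s≡lin t (act a y) ⟩
    lin (act a y) (pr (lookup (act a y)) t) (α t)  ≡⟨ cong₂ (lin (act a y)) pr-eq (sym e) ⟩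
    lin (act a y) (pr (lookup y) k) (act a (α k))  ≡⟨ act-lin a y (pr (lookup y) k) (α k) ⟨
    act a (lin y (pr (lookup y) k) (α k))          ≡⟨ cong (act a) (s≡lin k y) ⟨
    act a (s k y)                                  ∎
    where
    open ≡-Reasoning
    d-eq : + d t ≡ + d k
    d-eq = *-cancelˡ-≡ (+ 2) (+ d t) (+ d k) (trans (sym (B-αα t))
      (trans (cong (λ z → B (lookup z) (lookup z)) (sym e)) (trans (B-act a (α k) (α k)) (B-αα k))))
    pr-eq : pr (lookup (act a y)) t ≡ pr (lookup y) k
    pr-eq = *-cancelˡ-≡ (+ d t) _ _ {{d-nonZero t}} (begin
      + d t * pr (lookup (act a y)) t           ≡⟨ B-αˡ t (lookup (act a y)) ⟨
      B (lookup (α t)) (lookup (act a y))       ≡⟨ cong (λ z → B (lookup z) (lookup (act a y))) e ⟨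
      B (lookup (act a (α k))) (lookup (act a y)) ≡⟨ B-act a (α k) y ⟩
      B (lookup (α k)) (lookup y)               ≡⟨ B-αˡ k (lookup y) ⟩
      + d k * pr (lookup y) k                   ≡⟨ cong (_* pr (lookup y) k) d-eq ⟨
      + d t * pr (lookup y) k                   ∎)

  -- Exchange: if u⁻¹ sends the positive root η = a α_k to a negative one,
  -- then the reflection s_η = a s_k a⁻¹ deletes a letter of u.
  exchange : ∀ u a k → NonNeg (act a (α k)) → NonPos (act (reverse u) (act a (α k))) →
             ∃[ u′ ] (length u′ ℕ.< length u × (∀ x → act a (s k (act (reverse a) (act u x))) ≡ act u′ x))
  exchange [] a k nn np = contradiction np (Root-not-both (Root-act a (Root-α k)) nn)
  exchange (t ∷ u) a k nn np with Root-s-NonNeg t (Root-act a (Root-α k)) nn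
  -- Here η = α_t, so s_η is s_t and cancels the first letter.
  ... | inj₁ e = u , ℕₚ.n<1+n _ , λ x → begin
    act a (s k (act (reverse a) (s t (act u x))))    ≡⟨ act-conj a k t e _ ⟨
    s t (act a (act (reverse a) (s t (act u x))))    ≡⟨ cong (s t) (act-inverseʳ a _) ⟩
    s t (s t (act u x))                              ≡⟨ s-involutive t _ ⟩
    act u x                                          ∎
    where open ≡-Reasoning
  -- Otherwise s_t η is still positive, and the search goes on in u with the conjugating word t ∷ a.
  ... | inj₂ nn′ with exchange u (t ∷ a) k nn′ (subst NonPos (act-reverse-∷ t u _) np)
  ... | u′ , len , eq = t ∷ u′ , ℕ.s≤s len , λ x → begin
    act a (s k (act (reverse a) (s t (act u x))))
      ≡⟨ s-involutive t _ ⟨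
    s t (s t (act a (s k (act (reverse a) (s t (act u x))))))
      ≡⟨ cong (λ z → s t (s t (act a (s k z)))) (act-reverse-∷ t a (act u x)) ⟨
    s t (s t (act a (s k (act (reverse (t ∷ a)) (act u x)))))
      ≡⟨ cong (s t) (eq x) ⟩
    s t (act u′ x) ∎
    where open ≡-Reasoning

  -- If the word is k ∷ u, positivity of its inverse on α_k makes u⁻¹α_k negative. Exchange with η =
  -- α_k then gives a word shorter than u with the same action as k ∷ u, and induction on the length
  -- applies.
  positive⇒trivial : ∀ u → (∀ k → NonNeg (act (reverse u) (α k))) → u ≈ []
  positive⇒trivial u = go (suc (length u)) u (ℕₚ.n<1+n _)
    where
    go : ∀ h u → length u ℕ.< h → (∀ k → NonNeg (act (reverse u) (α k))) → u ≈ []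
    go (suc h) []      l pos x = refl
    go (suc h) (k ∷ u) (ℕ.s≤s l) pos x = trans (u≈u′ x) (go h u′ (ℕₚ.<-≤-trans l′ (ℕₚ.≤-trans (ℕₚ.n≤1+n _) l))
      (λ m → subst NonNeg (≈-reverse {k ∷ u} {u′} u≈u′ (α m)) (pos m)) x)
      where
      flipped : NonPos (act (reverse u) (α k))
      flipped = NonNeg-neg⇒NonPos {act (reverse u) (α k)} (subst NonNeg
        (trans (act-reverse-∷ k u (α k)) (trans (cong (act (reverse u)) (s-α k)) (act-neg (reverse u) (α k))))
        (pos k))
      shorter : ∃[ u′ ] (length u′ ℕ.< length u × (k ∷ u ≈ u′))
      shorter = exchange u [] k (NonNeg-α k) flipped
      u′ : Word C
      u′ = proj₁ shorter
      l′ : length u′ ℕ.< length u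
      l′ = proj₁ (proj₂ shorter)
      u≈u′ : k ∷ u ≈ u′
      u≈u′ = proj₂ (proj₂ shorter)

  -- Coweights

  σ : Fin n → Vec ℤ n → Vec ℤ n
  σ = sCo C

  actᵛ : Word C → Vec ℤ n → Vec ℤ n
  actᵛ = actCo C

  φ : Fin n → Vec ℤ n
  φ = φ∨ C

  ⟪_,_⟫ : Vec ℤ n → Vec ℤ n → ℤ
  ⟪ v , β ⟫ = sumF (λ m → lookup v m * lookup β m)

  lookup-σ : ∀ k v m → lookup (σ k v) m ≡ lookup v m - lookup v k * C k m
  lookup-σ k v m = lookup∘tabulate _ m

  pair-s : ∀ k v β → ⟪ σ k v , s k β ⟫ ≡ ⟪ v , β ⟫
  pair-s k v β = begin
    ⟪ σ k v , s k β ⟫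
      ≡⟨ sumF-cong {n} (λ m → trans (cong (_*_ (lookup (σ k v) m)) (lookup-s k β m))
                                    (r₁ (lookup (σ k v) m) (lookup β m) p (δ k m))) ⟩
    sumF (λ m → lookup (σ k v) m * lookup β m - p * (lookup (σ k v) m * δ k m))
      ≡⟨ sumF-sub {n} p (λ m → lookup (σ k v) m * lookup β m) (λ m → lookup (σ k v) m * δ k m) ⟩
    ⟪ σ k v , β ⟫ - p * sumF (λ m → lookup (σ k v) m * δ k m)
      ≡⟨ cong₂ (λ a b → a - p * b) pair-σ
           (trans (sumF-δ (lookup (σ k v)) k) (trans (lookup-σ k v k) (cong (λ c → vk - vk * c) (diag k)))) ⟩
    (⟪ v , β ⟫ - vk * p) - p * (vk - vk * + 2)
      ≡⟨ r₃ ⟪ v , β ⟫ vk p ⟩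
    ⟪ v , β ⟫ ∎
    where
    open ≡-Reasoning
    p vk : ℤ
    p  = pr (lookup β) k
    vk = lookup v k
    r₁ : ∀ a b p e → a * (b - p * e) ≡ a * b - p * (a * e)
    r₁ = solve-∀
    r₂ : ∀ a b c e → (a - b * c) * e ≡ a * e - b * (e * c)
    r₂ = solve-∀
    r₃ : ∀ z a p → (z - a * p) - p * (a - a * + 2) ≡ z
    r₃ = solve-∀
    pair-σ : ⟪ σ k v , β ⟫ ≡ ⟪ v , β ⟫ - vk * p
    pair-σ = trans (sumF-cong {n} (λ m → trans (cong (_* lookup β m) (lookup-σ k v m))
                                               (r₂ (lookup v m) vk (C k m) (lookup β m))))
                   (sumF-sub {n} vk (λ m → lookup v m * lookup β m) (λ m → lookup β m * C k m))

  pair-act : ∀ w v β → ⟪ actᵛ w v , act w β ⟫ ≡ ⟪ v , β ⟫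
  pair-act []      v β = refl
  pair-act (k ∷ w) v β = trans (pair-s k (actᵛ w v) (act w β)) (pair-act w v β)

  pair-α : ∀ v k → ⟪ v , α k ⟫ ≡ lookup v k
  pair-α v k = trans (sumF-cong {n} (λ m → cong (_*_ (lookup v m)) (lookup-α k m))) (sumF-δ (lookup v) k)

  pair-φ : ∀ j β → ⟪ φ j , β ⟫ ≡ lookup β j
  pair-φ j β = trans (sumF-cong {n} (λ m → trans (cong (_* lookup β m) (lookup∘tabulate (δ j) m)) (*-comm (δ j m) _)))
                     (sumF-δ (lookup β) j)

  -- Invariance of the pairing moves w onto α_k. In the abelian case this bounds the coordinates of
  -- weights by coefficients of roots.
  lookup-actᵛ-φ : ∀ w j k → lookup (actᵛ w (φ j)) k ≡ lookup (act (reverse w) (α k)) j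
  lookup-actᵛ-φ w j k = begin
    lookup (actᵛ w (φ j)) k                             ≡⟨ pair-α (actᵛ w (φ j)) k ⟨
    ⟪ actᵛ w (φ j) , α k ⟫                              ≡⟨ cong ⟪ actᵛ w (φ j) ,_⟫ (act-inverseʳ w (α k)) ⟨
    ⟪ actᵛ w (φ j) , act w (act (reverse w) (α k)) ⟫    ≡⟨ pair-act w (φ j) (act (reverse w) (α k)) ⟩
    ⟪ φ j , act (reverse w) (α k) ⟫                     ≡⟨ pair-φ j (act (reverse w) (α k)) ⟩
    lookup (act (reverse w) (α k)) j                    ∎
    where open ≡-Reasoning

  ≈⇒actᵛ-φ : ∀ {u w} → u ≈ w → ∀ j → actᵛ u (φ j) ≡ actᵛ w (φ j)
  ≈⇒actᵛ-φ {u} {w} e j = vec-ext (λ k → trans (lookup-actᵛ-φ u j k)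
    (trans (cong (λ x → lookup x j) (≈-reverse {u} {w} e (α k))) (sym (lookup-actᵛ-φ w j k))))

  act-expand : ∀ w β m → lookup (act w β) m ≡ sumF (λ j → lookup (act w (α j)) m * lookup β j)
  act-expand w β m = begin
    lookup (act w β) m                                     ≡⟨ pair-φ m (act w β) ⟨
    ⟪ φ m , act w β ⟫                                      ≡⟨ pair-act (reverse w) (φ m) (act w β) ⟨
    ⟪ actᵛ (reverse w) (φ m) , act (reverse w) (act w β) ⟫ ≡⟨ cong ⟪ actᵛ (reverse w) (φ m) ,_⟫ (act-inverseˡ w β) ⟩
    ⟪ actᵛ (reverse w) (φ m) , β ⟫
      ≡⟨ sumF-cong {n} (λ j → cong (_* lookup β j) (trans (lookup-actᵛ-φ (reverse w) m j)
           (cong (λ u → lookup (act u (α j)) m) (reverse-involutive w)))) ⟩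
    sumF (λ j → lookup (act w (α j)) m * lookup β j)       ∎
    where open ≡-Reasoning

  infix 4 _⊑_
  -- This is `_≼P_` on bare vectors, freed from the orbit witnesses.
  _⊑_ : Vec ℤ n → Vec ℤ n → Set
  v ⊑ v′ = Σ (Fin n → ℕ) (λ c → ∀ m → lookup v′ m - lookup v m ≡ sumF (λ k → + c k * C k m))

  ⊑-refl : ∀ v → v ⊑ v
  ⊑-refl v = (λ _ → 0) , λ m → trans (+-inverseʳ (lookup v m))
    (sym (trans (sumF-cong {n} (λ k → *-zeroˡ (C k m))) (sumF-0 {n})))

  ⊑-trans : ∀ {u v w} → u ⊑ v → v ⊑ w → u ⊑ w
  ⊑-trans {u} {v} {w} (c , p) (c′ , p′) = (λ k → c k ℕ.+ c′ k) , λ m → begin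
    lookup w m - lookup u m
      ≡⟨ r (lookup w m) (lookup v m) (lookup u m) ⟩
    (lookup v m - lookup u m) + (lookup w m - lookup v m)
      ≡⟨ cong₂ _+_ (p m) (p′ m) ⟩
    sumF (λ k → + c k * C k m) + sumF (λ k → + c′ k * C k m)
      ≡⟨ sumF-+ {n} (λ k → + c k * C k m) (λ k → + c′ k * C k m) ⟨
    sumF (λ k → + c k * C k m + + c′ k * C k m)
      ≡⟨ sumF-cong {n} (λ k → trans (sym (*-distribʳ-+ (C k m) (+ c k) (+ c′ k)))
                                    (cong (_* C k m) (sym (pos-+ (c k) (c′ k))))) ⟩
    sumF (λ k → + (c k ℕ.+ c′ k) * C k m) ∎
    where
    open ≡-Reasoning
    r : ∀ a b c → a - c ≡ (b - c) + (a - b)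
    r = solve-∀

  σ-⊑ : ∀ k v → lookup v k ≡ 1ℤ → σ k v ⊑ v
  σ-⊑ k v e = (λ m → ∣ δ k m ∣) , λ m → begin
    lookup v m - lookup (σ k v) m
      ≡⟨ cong (λ t → lookup v m - t) (trans (lookup-σ k v m) (cong (λ t → lookup v m - t * C k m) e)) ⟩
    lookup v m - (lookup v m - 1ℤ * C k m)
      ≡⟨ r (lookup v m) (C k m) ⟩
    C k m
      ≡⟨ sumF-δ (λ l → C l m) k ⟨
    sumF (λ l → C l m * δ k l)
      ≡⟨ sumF-cong {n} (λ l → trans (*-comm (C l m) (δ k l)) (cong (_* C l m) (sym (0≤i⇒+∣i∣≡i (δ-nonneg k l))))) ⟩
    sumF (λ l → + ∣ δ k l ∣ * C l m) ∎
    where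
    open ≡-Reasoning
    r : ∀ a c → a - (a - 1ℤ * c) ≡ c
    r = solve-∀

  -- Positive definiteness on the coroot lattice, whose basis α_k^∨ is α_k / d_k up to scale.
  coroot-ascent : ∀ (c : Fin n → ℕ) m → c m ≢ 0 →
                  ∃[ k ] (0 ℕ.< c k × 0ℤ < sumF (λ j → + c j * C j k))
  coroot-ascent c m c≢0 with commonMultiple d d-pos
  ... | e , D , 0<e , 0<D , ed≡D = k , 0<ck , proj₂ (*-pos⁻¹ (<⇒≤ 0<D) (proj₂ split))
    where
    -- As e_j = D / d_j, these are the simple-root coordinates of D Σ c_j α_j^∨.
    y : Fin n → ℤ
    y j = + c j * e j
    x : Fin n → ℤ
    x k = sumF (λ j → + c j * C j k)
    r₁ : ∀ a c e f → a * (c * e * f) ≡ c * (e * (a * f))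
    r₁ = solve-∀
    r₂ : ∀ a c e f → c * (e * (a * f)) ≡ e * a * (c * f)
    r₂ = solve-∀
    dpr : ∀ k → + d k * pr y k ≡ D * x k
    dpr k = trans (sym (sumF-* {n} (+ d k) (λ j → y j * C k j)))
      (trans (sumF-cong {n} (λ j → trans (r₁ (+ d k) (+ c j) (e j) (C k j))
        (trans (cong (λ t → + c j * (e j * t)) (symm k j))
        (trans (r₂ (+ d j) (+ c j) (e j) (C j k)) (cong (_* (+ c j * C j k)) (ed≡D j))))))
        (sumF-* {n} D (λ j → + c j * C j k)))
    y≢0 : y m ≢ 0ℤ
    y≢0 y≡0 with i*j≡0⇒i≡0∨j≡0 (+ c m) y≡0
    ... | inj₁ p = c≢0 (+-injective p)
    ... | inj₂ p = <⇒≢ (0<e m) (sym p)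
    pick : ∃[ k ] 0ℤ < y k * (+ d k * pr y k)
    pick = sumF-pos {n} _ (B-posdef y m y≢0)
    k : Fin n
    k = proj₁ pick
    split : 0ℤ < y k × 0ℤ < D * x k
    split = *-pos⁻¹ (*-nonneg {+ c k} (+≤+ ℕ.z≤n) (<⇒≤ (0<e k)))
                    (subst (λ t → 0ℤ < y k * t) (dpr k) (proj₂ pick))
    0<ck : 0 ℕ.< c k
    0<ck = drop‿+<+ (proj₁ (*-pos⁻¹ {+ c k} {e k} (+≤+ ℕ.z≤n) (proj₁ split)))

-- The abelian case

module Abelian {n : ℕ} (C : Cartan n) (cartan : IsSimpleCartan C)
               (i : Fin n) (θ : Vec ℤ n) (highest : IsHighestRoot C θ) (θᵢ≡1 : lookup θ i ≡ 1ℤ) where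
  open RootSystem C cartan

  Posroot : Vec ℤ n → Set
  Posroot = IsPosRoot C

  Posroot? : Decidable Posroot
  Posroot? γ = Root? γ ×-dec Finₚ.all? (λ m → 0ℤ ≤? lookup γ m)

  Level1 : Vec ℤ n → Set
  Level1 = Δ1 C i

  Level1? : Decidable Level1
  Level1? γ = Root? γ ×-dec (lookup γ i ℤₚ.≟ 1ℤ)

  Below : Vec ℤ n → Vec ℤ n → Set
  Below = _≼_ C i

  Below? : ∀ μ γ → Dec (Below μ γ)
  Below? μ γ = Finₚ.all? (λ m → lookup μ m ≤? lookup γ m) ×-dec (lookup μ i ℤₚ.≟ lookup γ i)

  -- Inversion sets of elements of W⁰

  Inv : Word C → Vec ℤ n → Set
  Inv = InN C

  Inv? : ∀ w → Decidable (Inv w)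
  Inv? w γ = Posroot? γ ×-dec Posroot? (neg (act w γ))

  W0 : Word C → Set
  W0 = InW0 C i

  wt : Word C → Vec ℤ n
  wt w = actᵛ w (φ i)

  Inv-intro : ∀ {w γ} → Root γ → NonNeg γ → NonPos (act w γ) → Inv w γ
  Inv-intro {w} {γ} r nn np = (r , nn) , Root-neg (Root-act w r) , NonPos⇒NonNeg-neg {x = act w γ} np

  Inv-NonPos : ∀ {w γ} → Inv w γ → NonPos (act w γ)
  Inv-NonPos {w} {γ} (_ , _ , nn) = NonNeg-neg⇒NonPos {x = act w γ} nn

  ¬Inv-NonNeg : ∀ {w γ} → Root γ → NonNeg γ → ¬ Inv w γ → NonNeg (act w γ)
  ¬Inv-NonNeg {w} {γ} r nn ¬inv =
    [ id , (λ np → contradiction (Inv-intro {w} {γ} r nn np) ¬inv) ]′ (Root-coherent (Root-act w r))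

  NonNeg⇒¬Inv : ∀ {w γ} → NonNeg (act w γ) → ¬ Inv w γ
  NonNeg⇒¬Inv {w} {γ} nn inv = Root-not-both (Root-act w (proj₁ (proj₁ inv))) nn (Inv-NonPos {w} {γ} inv)

  -- Here the abelian hypothesis enters: θ bounds all roots coordinatewise and has level 1. Applied
  -- to -β, it also bounds levels below by -1.
  coord≤1 : ∀ {β} → Root β → lookup β i ≤ 1ℤ
  coord≤1 r = subst (_ ≤_) θᵢ≡1 (proj₂ highest _ r i)

  coord-trichotomy : ∀ {β} → Root β → lookup β i ≡ -1ℤ ⊎ lookup β i ≡ 0ℤ ⊎ lookup β i ≡ 1ℤ
  coord-trichotomy {β} r = between-±1
    (neg-cancel-≤ (subst (_≤ 1ℤ) (lookup-neg β i) (coord≤1 (Root-neg r)))) (coord≤1 r)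

  Level1-NonNeg : ∀ {γ} → Level1 γ → NonNeg γ
  Level1-NonNeg {γ} (r , e) =
    [ id , (λ np → contradiction (subst (_≤ 0ℤ) e (np i)) λ { (+≤+ ()) }) ]′ (Root-coherent r)

  W0-NonNeg : ∀ {w β} → W0 w → Root β → lookup β i ≡ 0ℤ → NonNeg β → NonNeg (act w β)
  W0-NonNeg w0 r e nn = proj₂ (w0 _ ((r , nn) , e))

  -- If β were negative, w would make -β positive, and wβ would have both signs.
  W0-NonNeg⁻¹ : ∀ {w β} → W0 w → Root β → lookup β i ≡ 0ℤ → NonNeg (act w β) → NonNeg β
  W0-NonNeg⁻¹ {w} {β} w0 r e nn =
    [ id , (λ np → contradiction (nonPos′ np) (Root-not-both (Root-act w r) nn)) ]′ (Root-coherent r)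
    where
    nonPos′ : NonPos β → NonPos (act w β)
    nonPos′ np = NonNeg-neg⇒NonPos {x = act w β} (subst NonNeg (act-neg w β)
      (W0-NonNeg {w} {neg β} w0 (Root-neg r) (trans (lookup-neg β i) (cong -_ e)) (NonPos⇒NonNeg-neg {x = β} np)))

  -- A positive root has level 0 or 1, and w ∈ W⁰ keeps those of level 0 positive.
  Inv⇒Level1 : ∀ {w γ} → W0 w → Inv w γ → Level1 γ
  Inv⇒Level1 {w} {γ} w0 inv@((r , nn) , _) = cases (coord-trichotomy r)
    where
    cases : lookup γ i ≡ -1ℤ ⊎ lookup γ i ≡ 0ℤ ⊎ lookup γ i ≡ 1ℤ → Level1 γ
    cases (inj₁ e)        = contradiction (subst (0ℤ ≤_) e (nn i)) λ ()
    cases (inj₂ (inj₁ e)) = contradiction (Inv-NonPos {w} {γ} inv)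
                              (Root-not-both (Root-act w r) (W0-NonNeg {w} {γ} w0 r e nn))
    cases (inj₂ (inj₂ e)) = r , e

  W0-[] : W0 []
  W0-[] α₀ ((p , _)) = p

  Inv-[] : ∀ {γ} → ¬ Inv [] γ
  Inv-[] {γ} inv@((r , nn) , _) = Root-not-both r nn (Inv-NonPos {[]} {γ} inv)

  wt-coord : ∀ w k γ → act w γ ≡ α k → lookup (wt w) k ≡ lookup γ i
  wt-coord w k γ e = trans (lookup-actᵛ-φ w i k)
    (cong (λ x → lookup x i) (trans (cong (act (reverse w)) (sym e)) (act-inverseˡ w γ)))

  wt-trichotomy : ∀ w k → lookup (wt w) k ≡ -1ℤ ⊎ lookup (wt w) k ≡ 0ℤ ⊎ lookup (wt w) k ≡ 1ℤ
  wt-trichotomy w k = subst (λ t → t ≡ -1ℤ ⊎ t ≡ 0ℤ ⊎ t ≡ 1ℤ) (sym (lookup-actᵛ-φ w i k))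
    (coord-trichotomy (Root-act (reverse w) (Root-α k)))

  -- The only positive root that s_k makes negative is α_k. If it were wγ with γ of level 0, then
  -- ⟨wφ , α_k⟩ would be that level, 0.
  W0-∷ : ∀ {w} k → W0 w → lookup (wt w) k ≢ 0ℤ → W0 (k ∷ w)
  W0-∷ {w} k w0 wₖ≢0 γ ((r , nn) , e) = Root-act (k ∷ w) r ,
    [ (λ wγ≡α → contradiction (trans (wt-coord w k γ wγ≡α) e) wₖ≢0) , id ]′
      (Root-s-NonNeg k (Root-act w r) (W0-NonNeg {w} {γ} w0 r e nn))

  -- An inversion is lost only if wγ = -α_k; as γ has level 1, this would mean ⟨wφ , α_k⟩ = -1.
  Inv-grow : ∀ {w γ} k → W0 w → lookup (wt w) k ≡ 1ℤ → Inv w γ → Inv (k ∷ w) γ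
  Inv-grow {w} {γ} k w0 wₖ≡1 inv@((r , nn) , _) = Inv-intro {k ∷ w} {γ} r nn
    ([ (λ wγ≡-α → contradiction (trans (sym wₖ≡1) (coord wγ≡-α)) λ ()) , id ]′
      (Root-s-NonPos k (Root-act w r) (Inv-NonPos {w} {γ} inv)))
    where
    coord : act w γ ≡ neg (α k) → lookup (wt w) k ≡ -1ℤ
    coord e = trans (wt-coord w k (neg γ) (trans (act-neg w γ) (trans (cong neg e) (neg-involutive′ (α k)))))
      (trans (lookup-neg γ i) (cong -_ (proj₂ (Inv⇒Level1 {w} {γ} w0 inv))))

  Inv-∷⁻¹ : ∀ {w γ} k → Inv (k ∷ w) γ → Inv w γ ⊎ act w γ ≡ α k
  Inv-∷⁻¹ {w} {γ} k inv@((r , nn) , _) =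
    [ inj₂ ∘ simple-image , inj₁ ∘ Inv-intro {w} {γ} r nn ]′ (Root-coherent (Root-act w r))
    where
    simple-image : NonNeg (act w γ) → act w γ ≡ α k
    simple-image wγ≥0 =
      [ id , (λ swγ≥0 → contradiction (Inv-NonPos {k ∷ w} {γ} inv) (Root-not-both (Root-act (k ∷ w) r) swγ≥0)) ]′
        (Root-s-NonNeg k (Root-act w r) wγ≥0)

  -- γ - μ is a nonnegative combination of simple roots other than α_i, and w sends these to
  -- positive roots. Hence wμ ≤ wγ ≤ 0 coordinatewise.
  Inv-lower : ∀ {w μ γ} → W0 w → Inv w γ → Level1 μ → Below μ γ → Inv w μ
  Inv-lower {w} {μ} {γ} w0 inv lμ (μ≤γ , μᵢ≡γᵢ) = Inv-intro {w} {μ} (proj₁ lμ) (Level1-NonNeg lμ)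
    (λ m → ≤-trans (0≤i-j⇒j≤i (subst (0ℤ ≤_) (sym (eq m)) (sumF-nonneg {n} (term m)))) (Inv-NonPos {w} {γ} inv m))
    where
    r : ∀ a b c → a * b - 1ℤ * (a * c) ≡ a * (b - c)
    r = solve-∀
    eq : ∀ m → lookup (act w γ) m - lookup (act w μ) m ≡
             sumF (λ j → lookup (act w (α j)) m * (lookup γ j - lookup μ j))
    eq m = trans (cong₂ _-_ (act-expand w γ m) (trans (act-expand w μ m) (sym (*-identityˡ _))))
      (trans (sym (sumF-sub {n} 1ℤ (λ j → lookup (act w (α j)) m * lookup γ j)
                                 (λ j → lookup (act w (α j)) m * lookup μ j)))
        (sumF-cong {n} (λ j → r (lookup (act w (α j)) m) (lookup γ j) (lookup μ j))))
    term : ∀ m j → 0ℤ ≤ lookup (act w (α j)) m * (lookup γ j - lookup μ j)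
    term m j with i ≟ j
    ... | yes refl = ≤-reflexive (sym (trans (cong (_*_ (lookup (act w (α i)) m)) (i≡j⇒i-j≡0 (sym μᵢ≡γᵢ)))
                                             (*-zeroʳ (lookup (act w (α i)) m))))
    ... | no i≢j = *-nonneg (W0-NonNeg {w} {α j} w0 (Root-α j) (trans (lookup-α j i) (δ-≢ (i≢j ∘ sym))) (NonNeg-α j) m)
                            (i≤j⇒0≤j-i (μ≤γ j))

  -- Elements of W⁰ are determined by their weights and by their inversion sets

  W0-representative : ∀ u → ∃[ w ] (W0 w × wt w ≡ actᵛ u (φ i))
  W0-representative []      = [] , W0-[] , refl
  W0-representative (k ∷ u) with W0-representative u
  ... | w , w0 , e with lookup (wt w) k ℤₚ.≟ 0ℤ
  ... | no wₖ≢0  = k ∷ w , W0-∷ {w} k w0 wₖ≢0 , cong (σ k) e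
  ... | yes wₖ≡0 = w , w0 , trans (sym fixed) (cong (σ k) e)
    where
    fixed : σ k (wt w) ≡ wt w
    fixed = vec-ext (λ m → trans (lookup-σ k (wt w) m) (trans (cong (λ t → lookup (wt w) m - t * C k m) wₖ≡0)
      (+-identityʳ (lookup (wt w) m))))

  act-reverse-++ : ∀ u w x → act (reverse (u ++ w)) x ≡ act (reverse w) (act (reverse u) x)
  act-reverse-++ u w x = trans (cong (λ z → act z x) (reverse-++ u w)) (act-++ (reverse w) (reverse u) x)

  -- w⁻¹w′ fixes φ and so preserves levels. It sends α_i to a root of level 1, which is positive,
  -- and the other simple roots to roots of level 0, which are positive because w and w′ lie in W⁰.
  wt-injective : ∀ {w w′} → W0 w → W0 w′ → wt w ≡ wt w′ → w ≈ w′
  wt-injective {w} {w′} w0 w0′ e x = trans (sym (act-inverseʳ w′ (act w x)))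
    (cong (act w′) (trans (sym (act-++ (reverse w′) w x)) (positive⇒trivial (reverse w′ ++ w) preserved x)))
    where
    preserved : ∀ k → NonNeg (act (reverse (reverse w′ ++ w)) (α k))
    preserved k = subst NonNeg (sym (trans (act-reverse-++ (reverse w′) w (α k))
      (cong (λ u → act (reverse w) (act u (α k))) (reverse-involutive w′)))) (β-NonNeg (i ≟ k))
      where
      β : Vec ℤ n
      β = act (reverse w) (act w′ (α k))
      β-root : Root β
      β-root = Root-act (reverse w) (Root-act w′ (Root-α k))
      βᵢ : lookup β i ≡ lookup (α k) i
      βᵢ = begin
        lookup β i               ≡⟨ pair-φ i β ⟨
        ⟪ φ i , β ⟫              ≡⟨ pair-act w (φ i) β ⟨
        ⟪ wt w , act w β ⟫       ≡⟨ cong₂ ⟪_,_⟫ e (act-inverseʳ w (act w′ (α k))) ⟩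
        ⟪ wt w′ , act w′ (α k) ⟫ ≡⟨ pair-act w′ (φ i) (α k) ⟩
        ⟪ φ i , α k ⟫            ≡⟨ pair-φ i (α k) ⟩
        lookup (α k) i           ∎
        where open ≡-Reasoning
      β-NonNeg : Dec (i ≡ k) → NonNeg β
      β-NonNeg (yes refl) = Level1-NonNeg (β-root , trans βᵢ (trans (lookup-α i i) (δ-refl i)))
      β-NonNeg (no i≢k)   = W0-NonNeg⁻¹ {w} {β} w0 β-root (trans βᵢ αᵢ≡0)
        (subst NonNeg (sym (act-inverseʳ w (act w′ (α k)))) (W0-NonNeg {w′} {α k} w0′ (Root-α k) αᵢ≡0 (NonNeg-α k)))
        where
        αᵢ≡0 : lookup (α k) i ≡ 0ℤ
        αᵢ≡0 = trans (lookup-α k i) (δ-≢ (i≢k ∘ sym))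

  -- Let η = w⁻¹α_k. If η is positive, it is not in N(w) = N(w′); if it is negative, -η is in both.
  -- Either way w′η = w′w⁻¹α_k is positive.
  Inv-injective : ∀ {w w′} → (∀ γ → Inv w γ → Inv w′ γ) → (∀ γ → Inv w′ γ → Inv w γ) → w ≈ w′
  Inv-injective {w} {w′} fwd bwd x = trans (cong (act w) (sym (act-inverseˡ w′ x)))
    (trans (sym (act-++ w (reverse w′) (act w′ x))) (positive⇒trivial (w ++ reverse w′) preserved (act w′ x)))
    where
    preserved : ∀ k → NonNeg (act (reverse (w ++ reverse w′)) (α k))
    preserved k = subst NonNeg (sym (trans (act-reverse-++ w (reverse w′) (α k))
      (cong (λ u → act u (act (reverse w) (α k))) (reverse-involutive w′)))) (cases (Root-coherent η-root))
      where
      η : Vec ℤ n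
      η = act (reverse w) (α k)
      η-root : Root η
      η-root = Root-act (reverse w) (Root-α k)
      wη≡α : act w η ≡ α k
      wη≡α = act-inverseʳ w (α k)
      cases : NonNeg η ⊎ NonPos η → NonNeg (act w′ η)
      cases (inj₁ nn) = ¬Inv-NonNeg {w′} {η} η-root nn (λ inv →
        NonNeg⇒¬Inv {w} {η} (subst NonNeg (sym wη≡α) (NonNeg-α k)) (bwd η inv))
      cases (inj₂ np) = subst NonNeg (trans (cong neg (act-neg w′ η)) (neg-involutive′ (act w′ η)))
        (NonPos⇒NonNeg-neg {x = act w′ (neg η)} (Inv-NonPos {w′} {neg η} (fwd (neg η)
          (Inv-intro {w} {neg η} (Root-neg η-root) (NonPos⇒NonNeg-neg {x = η} np)
            (subst NonPos (sym (trans (act-neg w η) (cong neg wη≡α)))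
              (NonPos-neg-α k))))))

  -- If v′ - v = Σ c_k α_k^∨ ≠ 0, some k has c_k > 0 and v′_k > v_k, so v′_k = 1 or v_k = -1; replacing
  -- w′ or w by its product with s_k decreases c_k and can only enlarge N(w′) or shrink N(w).
  wt-reflects : ∀ {w w′} → W0 w → W0 w′ → wt w ⊑ wt w′ → ∀ γ → Inv w′ γ → Inv w γ
  wt-reflects {w} {w′} w0 w0′ (c , eq) =
    go (suc ∣ sumF (+_ ∘ c) ∣) w w′ c w0 w0′ eq (<+suc∣∣ (sumF (+_ ∘ c)))
    where
    go : ∀ h w w′ (c : Fin n → ℕ) → W0 w → W0 w′ →
         (∀ m → lookup (wt w′) m - lookup (wt w) m ≡ sumF (λ k → + c k * C k m)) →
         sumF (+_ ∘ c) < + h → ∀ γ → Inv w′ γ → Inv w γ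
    go zero    w w′ c w0 w0′ eq l = contradiction (sumF-nonneg {n} (λ k → +≤+ ℕ.z≤n)) (<⇒≱ l)
    go (suc h) w w′ c w0 w0′ eq l with Finₚ.any? (λ k → ¬? (c k ℕₚ.≟ 0))
    ... | no c≡0 = λ γ inv → Inv-intro {w} {γ} (proj₁ (proj₁ inv)) (proj₂ (proj₁ inv))
                               (subst NonPos (sym (same γ)) (Inv-NonPos {w′} {γ} inv))
      where
      wt-same : ∀ m → lookup (wt w) m ≡ lookup (wt w′) m
      wt-same m = sym (i-j≡0⇒i≡j _ _ (trans (eq m) (trans
        (sumF-cong {n} (λ k → cong (λ b → + b * C k m) (decidable-stable (c k ℕₚ.≟ 0) (λ ne → c≡0 (k , ne)))))
        (trans (sumF-cong {n} (λ k → *-zeroˡ (C k m))) (sumF-0 {n})))))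
      same : w ≈ w′
      same = wt-injective {w} {w′} w0 w0′ (vec-ext wt-same)
    ... | yes (m₀ , c≢0) = step (wt-trichotomy w′ m) (wt-trichotomy w m)
      where
      pick : ∃[ m ] (0 ℕ.< c m × 0ℤ < sumF (λ j → + c j * C j m))
      pick = coroot-ascent c m₀ c≢0
      m : Fin n
      m = proj₁ pick
      v′ₘ vₘ : ℤ
      v′ₘ = lookup (wt w′) m
      vₘ  = lookup (wt w) m
      0<diff : 0ℤ < v′ₘ - vₘ
      0<diff = subst (0ℤ <_) (sym (eq m)) (proj₂ (proj₂ pick))
      -- This is c - δ_m; truncated subtraction is exact because c_m > 0.
      c′ : Fin n → ℕ
      c′ k = c k ℕ.∸ ∣ δ m k ∣
      c′-eq : ∀ k → + c′ k ≡ + c k - δ m k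
      c′-eq = pos-∸-δ c m (proj₁ (proj₂ pick))
      c′-sum : ∀ (f : Fin n → ℤ) → sumF (λ k → + c′ k * f k) ≡ sumF (λ k → + c k * f k) - f m
      c′-sum f = trans (sumF-cong {n} (λ k → trans (cong (_* f k) (c′-eq k)) (r (+ c k) (δ m k) (f k))))
        (trans (sumF-sub {n} 1ℤ (λ k → + c k * f k) (λ k → f k * δ m k))
               (cong (λ t → sumF (λ k → + c k * f k) - t) (trans (*-identityˡ _) (sumF-δ f m))))
        where
        r : ∀ a e f → (a - e) * f ≡ a * f - 1ℤ * (f * e)
        r = solve-∀
      smaller : sumF (+_ ∘ c′) < + h
      smaller = <-≤-trans (subst₂ _<_ (sym (trans (sumF-cong {n} (λ k → sym (*-identityʳ (+ c′ k))))
          (trans (c′-sum (λ _ → 1ℤ)) (cong (_- 1ℤ) (sumF-cong {n} (λ k → *-identityʳ (+ c k))))))) refl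
          (sub-pos-< (sumF (+_ ∘ c)) {1ℤ} (+<+ (ℕ.s≤s ℕ.z≤n))))
        (<+suc⇒≤ l)
      upper : v′ₘ ≡ 1ℤ → ∀ γ → Inv w′ γ → Inv w γ
      upper e γ inv = go h w (m ∷ w′) c′ w0 (W0-∷ {w′} m w0′ (λ z → contradiction (trans (sym e) z) λ ()))
        (λ l → trans (cong (_- lookup (wt w) l)
            (trans (lookup-σ m (wt w′) l) (cong (λ t → lookup (wt w′) l - t * C m l) e)))
          (trans (r (lookup (wt w′) l) (lookup (wt w) l) (C m l))
            (trans (cong (_- C m l) (eq l)) (sym (c′-sum (λ k → C k l))))))
        smaller γ (Inv-grow {w′} {γ} m w0′ e inv)
        where
        r : ∀ a b e → a - 1ℤ * e - b ≡ a - b - e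
        r = solve-∀
      lower : vₘ ≡ -1ℤ → ∀ γ → Inv w′ γ → Inv w γ
      -- A new inversion of s_m w would satisfy wγ = α_m, and then γ would have level v_m = -1
      -- although it is positive.
      lower e γ inv = [ id , (λ wγ≡α → contradiction
          (subst (0ℤ ≤_) (trans (sym (wt-coord w m γ wγ≡α)) e) (proj₂ (proj₁ inv) i)) λ ()) ]′
        (Inv-∷⁻¹ {w} {γ} m (go h (m ∷ w) w′ c′ (W0-∷ {w} m w0 (λ z → contradiction (trans (sym e) z) λ ())) w0′
          (λ l → trans (cong (_-_ (lookup (wt w′) l))
              (trans (lookup-σ m (wt w) l) (cong (λ t → lookup (wt w) l - t * C m l) e)))
            (trans (r (lookup (wt w′) l) (lookup (wt w) l) (C m l))
              (trans (cong (_- C m l) (eq l)) (sym (c′-sum (λ k → C k l))))))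
          smaller γ inv))
        where
        r : ∀ a b e → a - (b - -1ℤ * e) ≡ a - b - e
        r = solve-∀
      step : v′ₘ ≡ -1ℤ ⊎ v′ₘ ≡ 0ℤ ⊎ v′ₘ ≡ 1ℤ → vₘ ≡ -1ℤ ⊎ vₘ ≡ 0ℤ ⊎ vₘ ≡ 1ℤ → ∀ γ → Inv w′ γ → Inv w γ
      -- Among the values -1, 0, 1, the inequality v′_m > v_m leaves only v′_m = 1 or v_m = -1.
      step (inj₂ (inj₂ e)) _        = upper e
      step _               (inj₁ e) = lower e
      step (inj₁ p)        (inj₂ (inj₁ q)) = contradiction (subst₂ (λ a b → 0ℤ < a - b) p q 0<diff) λ ()
      step (inj₁ p)        (inj₂ (inj₂ q)) = contradiction (subst₂ (λ a b → 0ℤ < a - b) p q 0<diff) λ ()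
      step (inj₂ (inj₁ p)) (inj₂ (inj₁ q)) = contradiction (subst₂ (λ a b → 0ℤ < a - b) p q 0<diff) λ { (+<+ ()) }
      step (inj₂ (inj₁ p)) (inj₂ (inj₂ q)) = contradiction (subst₂ (λ a b → 0ℤ < a - b) p q 0<diff) λ ()

  -- Filling lower sets by simple steps

  -- The list contains Δ(1) and possibly other vectors; the predicates searched on it imply level 1.
  -- `deduplicate` supplies the `Unique` certificate that antichains require.
  level1 : List (Vec ℤ n)
  level1 = deduplicate _≟V_ (box θ)

  ∈-level1 : ∀ {γ} → Level1 γ → γ ∈ level1
  ∈-level1 {γ} l = ∈-deduplicate⁺ _≟V_ (∈-box θ γ (Level1-NonNeg l) (proj₂ highest γ (proj₁ l)))

  LowerSet : (Vec ℤ n → Set) → Set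
  LowerSet J = (∀ {γ} → J γ → Level1 γ) × (∀ {μ γ} → J γ → Level1 μ → Below μ γ → J μ)

  -- A positive root wγ that is not simple is a positive root plus a simple root α_k.  Of the two
  -- summands w⁻¹(wγ - α_k), w⁻¹α_k of γ, exactly one has level 1, and it lies below γ.
  addable : ∀ {J w} → LowerSet J → W0 w → ∀ {γ} → J γ → ¬ Inv w γ →
            ∃[ k ] (J (act (reverse w) (α k)) × ¬ Inv w (act (reverse w) (α k)))
  addable {J} {w} (J⊆ , J↓) w0 {γ} jγ ¬inv = go (suc ∣ height (act w γ) ∣) γ jγ ¬inv (<+suc∣∣ (height (act w γ)))
    where
    go : ∀ h γ → J γ → ¬ Inv w γ → height (act w γ) < + h →
         ∃[ k ] (J (act (reverse w) (α k)) × ¬ Inv w (act (reverse w) (α k)))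
    go h γ jγ ¬inv l = result
      where
      Result : Set
      Result = ∃[ k ] (J (act (reverse w) (α k)) × ¬ Inv w (act (reverse w) (α k)))
      β : Vec ℤ n
      β = act w γ
      γ-root : Root γ
      γ-root = proj₁ (J⊆ jγ)
      β-root : Root β
      β-root = Root-act w γ-root
      β-NonNeg : NonNeg β
      β-NonNeg = ¬Inv-NonNeg {w} {γ} γ-root (Level1-NonNeg (J⊆ jγ)) ¬inv
      pick : ∃[ k ] (0ℤ < lookup β k × 0ℤ < pr (lookup β) k)
      pick = Φ-ascent (proj₂ (Root⇒Φ β-root)) β-NonNeg
      k : Fin n
      k = proj₁ pick
      η : Vec ℤ n
      η = act (reverse w) (α k)
      η-root : Root η
      η-root = Root-act (reverse w) (Root-α k)
      wη≡α : act w η ≡ α k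
      wη≡α = act-inverseʳ w (α k)
      wη-NonNeg : NonNeg (act w η)
      wη-NonNeg = subst NonNeg (sym wη≡α) (NonNeg-α k)
      γ′ : Vec ℤ n
      γ′ = lin γ 1ℤ η
      wγ′≡ : act w γ′ ≡ lin β 1ℤ (α k)
      wγ′≡ = trans (act-lin w γ 1ℤ η) (cong (lin β 1ℤ) wη≡α)
      lookup-γ′ : ∀ m → lookup γ′ m ≡ lookup γ m - lookup η m
      lookup-γ′ m = trans (lookup-lin γ 1ℤ η m) (cong (λ t → lookup γ m - t) (*-identityˡ (lookup η m)))
      lookup-β′ : ∀ m → lookup (lin β 1ℤ (α k)) m ≡ lookup β m - δ k m
      lookup-β′ m = trans (lookup-lin β 1ℤ (α k) m)
        (cong (λ t → lookup β m - t) (trans (*-identityˡ (lookup (α k) m)) (lookup-α k m)))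
      wγ′-NonNeg : NonNeg (act w γ′)
      wγ′-NonNeg m = subst (0ℤ ≤_) (sym (trans (cong (λ x → lookup x m) wγ′≡) (lookup-β′ m))) (i≤j⇒0≤j-i δ≤β)
        where
        δ≤β : δ k m ≤ lookup β m
        δ≤β with k ≟ m
        ... | yes refl = i<j⇒suc[i]≤j (proj₁ (proj₂ pick))
        ... | no _     = β-NonNeg m
      γ′-root : β ≢ α k → Root γ′
      γ′-root β≢α = subst Root (trans (cong (act (reverse w)) (sym wγ′≡)) (act-inverseˡ w γ′))
        (Root-act (reverse w) (Root-sub-α k β-root (proj₂ (proj₂ pick)) β≢α))
      γ′ᵢ : lookup γ′ i ≡ 1ℤ - lookup η i
      γ′ᵢ = trans (lookup-γ′ i) (cong (_- lookup η i) (proj₂ (J⊆ jγ)))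
      height-γ′ : height (act w γ′) < height (act w γ)
      height-γ′ = subst (_< height β) (sym drop) (sub-pos-< (height β) {1ℤ} (+<+ (ℕ.s≤s ℕ.z≤n)))
        where
        height-δ : sumF (δ k) ≡ 1ℤ
        height-δ = trans (sumF-cong {n} (λ m → sym (*-identityˡ (δ k m)))) (sumF-δ (λ _ → 1ℤ) k)
        coord : ∀ m → lookup (act w γ′) m ≡ lookup β m - 1ℤ * δ k m
        coord m = trans (cong (λ x → lookup x m) wγ′≡)
          (trans (lookup-β′ m) (cong (λ t → lookup β m - t) (sym (*-identityˡ (δ k m)))))
        drop : height (act w γ′) ≡ height β - 1ℤ
        drop = trans (sumF-cong {n} coord) (trans (sumF-sub {n} 1ℤ (lookup β) (δ k))
          (cong (λ t → height β - t) (trans (*-identityˡ (sumF (δ k))) height-δ)))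
      η-addable : Level1 η → Below η γ → Result
      η-addable lη η≼γ = k , J↓ jγ lη η≼γ , NonNeg⇒¬Inv {w} {η} wη-NonNeg
      cases : β ≢ α k → lookup η i ≡ -1ℤ ⊎ lookup η i ≡ 0ℤ ⊎ lookup η i ≡ 1ℤ → Result
      -- The root γ′ = γ - η would have level 2.
      cases β≢α (inj₁ e) = contradiction
        (subst (_≤ 1ℤ) (trans γ′ᵢ (cong (_-_ 1ℤ) e)) (coord≤1 (γ′-root β≢α))) λ { (+≤+ (ℕ.s≤s ())) }
      -- η is positive of level 0, so γ′ lies in J below γ and outside N(w), and its image has
      -- smaller height.
      cases β≢α (inj₂ (inj₁ e)) = descend h l
        where
        lγ′ : Level1 γ′
        lγ′ = γ′-root β≢α , trans γ′ᵢ (cong (_-_ 1ℤ) e)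
        η-NonNeg : NonNeg η
        η-NonNeg = W0-NonNeg⁻¹ {w} {η} w0 η-root e wη-NonNeg
        γ′≼γ : Below γ′ γ
        γ′≼γ = (λ m → 0≤i-j⇒j≤i (subst (0ℤ ≤_) (sym
                 (trans (cong (_-_ (lookup γ m)) (lookup-γ′ m)) (r (lookup γ m) (lookup η m)))) (η-NonNeg m))) ,
               trans (proj₂ lγ′) (sym (proj₂ (J⊆ jγ)))
          where
          r : ∀ a b → a - (a - b) ≡ b
          r = solve-∀
        descend : ∀ h → height (act w γ) < + h → Result
        descend zero    l = contradiction (sumF-nonneg {n} β-NonNeg) (<⇒≱ l)
        descend (suc h) l = go h γ′ (J↓ jγ lγ′ γ′≼γ) (NonNeg⇒¬Inv {w} {γ′} wγ′-NonNeg) (<-≤-trans height-γ′ (<+suc⇒≤ l))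
      -- Now γ′ has level 0 and a positive image, so it is positive, and η itself lies below γ.
      cases β≢α (inj₂ (inj₂ e)) = η-addable (η-root , e)
        ((λ m → 0≤i-j⇒j≤i (subst (0ℤ ≤_) (lookup-γ′ m) (γ′-NonNeg m))) , trans e (sym (proj₂ (J⊆ jγ))))
        where
        γ′-NonNeg : NonNeg γ′
        γ′-NonNeg = W0-NonNeg⁻¹ {w} {γ′} w0 (γ′-root β≢α) (trans γ′ᵢ (cong (_-_ 1ℤ) e)) wγ′-NonNeg
      result : Result
      result with β ≟V α k
      ... | no β≢α = cases β≢α (coord-trichotomy η-root)
      ... | yes β≡α = k , subst J γ≡η jγ , subst (λ x → ¬ Inv w x) γ≡η ¬inv
        where
        γ≡η : γ ≡ η
        γ≡η = trans (sym (act-inverseˡ w γ)) (cong (act (reverse w)) β≡α)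

  -- The last component keeps track of the weight along the filling; monotonicity of the isomorphism
  -- is read off from it.
  Extension : Word C → (Vec ℤ n → Set) → Set
  Extension w J = ∃[ w′ ] (W0 w′ × (∀ γ → Inv w′ γ → J γ) × (∀ γ → J γ → Inv w′ γ) × wt w′ ⊑ wt w)

  -- The root η = w⁻¹α_k supplied by `addable` has level 1, which means ⟨wφ , α_k⟩ = 1. So prefixing
  -- k stays in W⁰, adds η to N(w) and lowers the weight by α_k^∨. The number of elements of J
  -- outside N(w) decreases.
  extend : ∀ {J} → Decidable J → LowerSet J → ∀ w → W0 w → (∀ γ → Inv w γ → J γ) → Extension w J
  extend {J} J? lower@(J⊆ , J↓) w w0 N⊆J = go (suc (length (missing w))) w w0 N⊆J (ℕₚ.n<1+n _)
    where
    Missing : Word C → Vec ℤ n → Set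
    Missing w γ = J γ × ¬ Inv w γ
    missing? : ∀ w → Decidable (Missing w)
    missing? w γ = J? γ ×-dec ¬? (Inv? w γ)
    missing : Word C → List (Vec ℤ n)
    missing w = filter (missing? w) level1
    go : ∀ h w → W0 w → (∀ γ → Inv w γ → J γ) → length (missing w) ℕ.< h → Extension w J
    go (suc h) w w0 N⊆J l = cases (any? (missing? w) level1)
      where
      grown : ∀ k → J (act (reverse w) (α k)) → ¬ Inv w (act (reverse w) (α k)) → Extension w J
      grown k jη ¬inv = proj₁ rest , proj₁ (proj₂ rest) , proj₁ (proj₂ (proj₂ rest)) , proj₁ (proj₂ (proj₂ (proj₂ rest))) ,
        ⊑-trans {wt (proj₁ rest)} {wt (k ∷ w)} {wt w} (proj₂ (proj₂ (proj₂ (proj₂ rest)))) (σ-⊑ k (wt w) wₖ≡1)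
        where
        η : Vec ℤ n
        η = act (reverse w) (α k)
        wη≡α : act w η ≡ α k
        wη≡α = act-inverseʳ w (α k)
        wₖ≡1 : lookup (wt w) k ≡ 1ℤ
        wₖ≡1 = trans (wt-coord w k η wη≡α) (proj₂ (J⊆ jη))
        w0′ : W0 (k ∷ w)
        w0′ = W0-∷ {w} k w0 (λ e → contradiction (trans (sym wₖ≡1) e) λ ())
        N′⊆J : ∀ γ → Inv (k ∷ w) γ → J γ
        N′⊆J γ inv = [ N⊆J γ , (λ wγ≡α → subst J (trans (cong (act (reverse w)) (sym wγ≡α)) (act-inverseˡ w γ)) jη) ]′
                     (Inv-∷⁻¹ {w} {γ} k inv)
        η∈N′ : Inv (k ∷ w) η
        η∈N′ = Inv-intro {k ∷ w} {η} (proj₁ (J⊆ jη)) (Level1-NonNeg (J⊆ jη))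
          (subst NonPos (sym (trans (cong (s k) wη≡α) (s-α k)))
            (NonPos-neg-α k))
        fewer : length (missing (k ∷ w)) ℕ.< length (missing w)
        fewer = length-filter-< (missing? (k ∷ w)) (missing? w)
          (λ {γ} (j , ¬inv′) → j , λ inv → ¬inv′ (Inv-grow {w} {γ} k w0 wₖ≡1 inv))
          (∈-level1 (J⊆ jη)) (λ (_ , ¬inv′) → ¬inv′ η∈N′) (jη , ¬inv)
        rest : Extension (k ∷ w) J
        rest = go h (k ∷ w) w0′ N′⊆J (ℕₚ.<-≤-trans fewer (ℕₚ.≤-pred l))
      cases : Dec (Any (Missing w) level1) → Extension w J
      cases (no none) = w , w0 , N⊆J ,
        (λ γ j → decidable-stable (Inv? w γ) (λ ¬inv → none (lose (∈-level1 (J⊆ j)) (j , ¬inv)))) ,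
        ⊑-refl (wt w)
      cases (yes some) with find some
      ... | γ , _ , jγ , ¬inv with addable {J} {w} lower w0 jγ ¬inv
      ... | k , jη , ¬invη = grown k jη ¬invη

  Inv-LowerSet : ∀ {w} → W0 w → LowerSet (Inv w)
  Inv-LowerSet {w} w0 = (λ {γ} → Inv⇒Level1 {w} {γ} w0) , λ {μ} {γ} → Inv-lower {w} {μ} {γ} w0

  wt-cong : ∀ {w w′} → (∀ γ → Inv w γ → Inv w′ γ) → (∀ γ → Inv w′ γ → Inv w γ) → wt w ≡ wt w′
  wt-cong {w} {w′} fwd bwd = ≈⇒actᵛ-φ {w} {w′} (Inv-injective {w} {w′} fwd bwd) i

  -- Filling N(w) from w′ ends at some u with uφ ≼ w′φ and N(u) = N(w), and equal inversion sets
  -- give uφ = wφ.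
  wt-antitone : ∀ {w w′} → W0 w → W0 w′ → (∀ γ → Inv w′ γ → Inv w γ) → wt w ⊑ wt w′
  wt-antitone {w} {w′} w0 w0′ N′⊆N with extend (Inv? w) (Inv-LowerSet {w} w0) w′ w0′ N′⊆N
  ... | u , _ , fwd , bwd , u⊑w′ = subst (_⊑ wt w′) (wt-cong {u} {w} fwd bwd) u⊑w′

  -- Antichains and upper ideals

  Below-trans : ∀ {x y z} → Below x y → Below y z → Below x z
  Below-trans (p , e) (q , f) = (λ m → ≤-trans (p m) (q m)) , trans e f

  Below-antisym : ∀ {x y} → Below x y → Below y x → x ≡ y
  Below-antisym (p , _) (q , _) = vec-ext (λ m → ≤-antisym (p m) (q m))

  Antichains : Set
  Antichains = AN C i

  Up : Antichains → Vec ℤ n → Set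
  Up = UpIdeal C i

  Up? : ∀ Γ → Decidable (Up Γ)
  Up? Γ β = Level1? β ×-dec map′ find (λ (_ , γ∈Γ , γ≼β) → lose γ∈Γ γ≼β) (any? (λ γ → Below? γ β) (proj₁ Γ))

  ∈⇒Up : ∀ Γ {β} → β ∈ proj₁ Γ → Up Γ β
  ∈⇒Up (_ , _ , lvl , _) {β} β∈Γ = All.lookup lvl β∈Γ , β , β∈Γ , (λ m → ≤-refl) , refl

  Co : Antichains → Vec ℤ n → Set
  Co Γ β = Level1 β × ¬ Up Γ β

  Co? : ∀ Γ → Decidable (Co Γ)
  Co? Γ β = Level1? β ×-dec ¬? (Up? Γ β)

  Co-LowerSet : ∀ Γ → LowerSet (Co Γ)
  Co-LowerSet Γ = proj₁ , λ { {μ} {γ} (lγ , ¬up) lμ μ≼γ → lμ ,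
    λ { (_ , ν , ν∈Γ , ν≼μ) → ¬up (lγ , ν , ν∈Γ , Below-trans {ν} {μ} {γ} ν≼μ μ≼γ) } }

  representative : ∀ Γ → Extension [] (Co Γ)
  representative Γ = extend (Co? Γ) (Co-LowerSet Γ) [] W0-[] (λ γ inv → contradiction inv (Inv-[] {γ}))

  rep : Antichains → Word C
  rep Γ = proj₁ (representative Γ)

  rep-W0 : ∀ Γ → W0 (rep Γ)
  rep-W0 Γ = proj₁ (proj₂ (representative Γ))

  Inv⇒Co : ∀ Γ γ → Inv (rep Γ) γ → Co Γ γ
  Inv⇒Co Γ = proj₁ (proj₂ (proj₂ (representative Γ)))

  Co⇒Inv : ∀ Γ γ → Co Γ γ → Inv (rep Γ) γ
  Co⇒Inv Γ = proj₁ (proj₂ (proj₂ (proj₂ (representative Γ))))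

  -- The word is constructed from Γ so that N(w) is the complement of I(Γ); `wt-rep-Γ` shows that
  -- for Γ = Γ_w the weight agrees with that of any given w ∈ W⁰.
  weightOf : Antichains → P C i
  weightOf Γ = wt (rep Γ) , rep Γ , refl

  Inv-rep-antitone : ∀ Γ Γ′ → (∀ β → Up Γ β → Up Γ′ β) → ∀ γ → Inv (rep Γ′) γ → Inv (rep Γ) γ
  Inv-rep-antitone Γ Γ′ sub γ inv = Co⇒Inv Γ γ (proj₁ co , proj₂ co ∘ sub γ)
    where
    co : Co Γ′ γ
    co = Inv⇒Co Γ′ γ inv

  reflects : ∀ Γ Γ′ → wt (rep Γ) ⊑ wt (rep Γ′) → ∀ β → Up Γ β → Up Γ′ β
  reflects Γ Γ′ Γ⊑Γ′ β up = decidable-stable (Up? Γ′ β) λ ¬up′ →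
    proj₂ (Inv⇒Co Γ β (wt-reflects {rep Γ} {rep Γ′} (rep-W0 Γ) (rep-W0 Γ′) Γ⊑Γ′ β (Co⇒Inv Γ′ β (proj₁ up , ¬up′)))) up

  -- An antichain consists of the minimal elements of its ideal. Below β ∈ Γ there is γ′ ∈ Γ′, and
  -- below γ′ some γ ∈ Γ; the antichain property gives γ = β, which squeezes γ′ to β.
  Up-⊆⇒∈ : ∀ Γ Γ′ → (∀ β → Up Γ β → Up Γ′ β) → (∀ β → Up Γ′ β → Up Γ β) → ∀ β → β ∈ proj₁ Γ → β ∈ proj₁ Γ′
  Up-⊆⇒∈ Γ Γ′ sub sup β β∈Γ with sub β (∈⇒Up Γ β∈Γ)
  ... | _ , γ′ , γ′∈Γ′ , γ′≼β with sup γ′ (∈⇒Up Γ′ γ′∈Γ′)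
  ... | _ , γ , γ∈Γ , γ≼γ′ = subst (_∈ proj₁ Γ′) γ′≡β γ′∈Γ′
    where
    γ≡β : γ ≡ β
    γ≡β = proj₂ (proj₂ (proj₂ Γ)) γ β γ∈Γ β∈Γ (Below-trans {γ} {γ′} {β} γ≼γ′ γ′≼β)
    γ′≡β : γ′ ≡ β
    γ′≡β = Below-antisym {γ′} {β} γ′≼β (subst (λ z → Below z γ′) γ≡β γ≼γ′)

  -- The antichain of minimal roots outside N(w)

  Outside : Word C → Vec ℤ n → Set
  Outside w γ = Level1 γ × ¬ Inv w γ

  Outside? : ∀ w → Decidable (Outside w)
  Outside? w γ = Level1? γ ×-dec ¬? (Inv? w γ)

  StrictlyBelow : Word C → Vec ℤ n → Vec ℤ n → Set
  StrictlyBelow w γ μ = Outside w μ × Below μ γ × μ ≢ γ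

  strictlyBelow? : ∀ w γ → Decidable (StrictlyBelow w γ)
  strictlyBelow? w γ μ = Outside? w μ ×-dec Below? μ γ ×-dec ¬? (μ ≟V γ)

  -- Minimality is the failure of a finite search, which makes it decidable; `Minimal-elim` recovers
  -- the quantified form used in `IsΓ`.
  Minimal : Word C → Vec ℤ n → Set
  Minimal w γ = Outside w γ × ¬ Any (StrictlyBelow w γ) level1

  Minimal? : ∀ w → Decidable (Minimal w)
  Minimal? w γ = Outside? w γ ×-dec ¬? (any? (strictlyBelow? w γ) level1)

  Minimal-elim : ∀ {w γ} → Minimal w γ → ∀ μ → Level1 μ → ¬ Inv w μ → Below μ γ → μ ≡ γ
  Minimal-elim {w} {γ} (_ , none) μ lμ ¬inv μ≼γ = decidable-stable (μ ≟V γ) λ μ≢γ →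
    none (lose (∈-level1 lμ) ((lμ , ¬inv) , μ≼γ , μ≢γ))

  minimals : Word C → List (Vec ℤ n)
  minimals w = filter (Minimal? w) level1

  ∈-minimals : ∀ {w γ} → Minimal w γ → γ ∈ minimals w
  ∈-minimals {w} min = ∈-filter⁺ (Minimal? w) (∈-level1 (proj₁ (proj₁ min))) min

  ∈-minimals⁻ : ∀ {w γ} → γ ∈ minimals w → Minimal w γ
  ∈-minimals⁻ {w} = proj₂ ∘ ∈-filter⁻ (Minimal? w) {xs = level1}

  minAntichain : Word C → Antichains
  minAntichain w = minimals w , Uniqueₚ.filter⁺ (Minimal? w) (DecUniqueₚ.deduplicate-! _≟V_ (box θ)) ,
    All.tabulate (proj₁ ∘ proj₁ ∘ ∈-minimals⁻ {w}) ,
    λ x y x∈ y∈ x≼y → Minimal-elim {w} {y} (∈-minimals⁻ {w} y∈) x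
      (proj₁ (proj₁ (∈-minimals⁻ {w} x∈))) (proj₂ (proj₁ (∈-minimals⁻ {w} x∈))) x≼y

  minAntichain-isΓ : ∀ w → IsΓ C i w (minAntichain w)
  minAntichain-isΓ w β = (λ β∈ → proj₁ (∈-minimals⁻ {w} β∈) , Minimal-elim {w} {β} (∈-minimals⁻ {w} β∈)) ,
    λ out min → ∈-minimals {w} (out , λ some → notBelow min (find some))
    where
    notBelow : (∀ μ → Level1 μ → ¬ Inv w μ → Below μ β → μ ≡ β) →
               ¬ (∃[ μ ] (μ ∈ level1 × StrictlyBelow w β μ))
    notBelow min (μ , _ , (lμ , ¬inv) , μ≼β , μ≢β) = μ≢β (min μ lμ ¬inv μ≼β)

  -- A strictly smaller root outside N(w) has smaller height, and heights on Δ(1) are nonnegative,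
  -- so descent ends at a minimal root. Thus the complement of N(w) in Δ(1) is contained in the
  -- ideal that Γ_w generates.
  minimal-below : ∀ w h γ → Outside w γ → height γ < + h → ∃[ μ ] (μ ∈ minimals w × Below μ γ)
  minimal-below w zero    γ out l = contradiction (sumF-nonneg {n} (Level1-NonNeg (proj₁ out))) (<⇒≱ l)
  minimal-below w (suc h) γ out l = cases (any? (strictlyBelow? w γ) level1)
    where
    shorter : ∀ {ν} → Below ν γ → ν ≢ γ → height ν < + h
    shorter {ν} (ν≤γ , _) ν≢γ =
      <-≤-trans (sumF-mono-< {n} ν≤γ (proj₁ differs) (≤∧≢⇒< (ν≤γ (proj₁ differs)) (proj₂ differs))) (<+suc⇒≤ l)
      where
      differs : ∃[ m ] lookup ν m ≢ lookup γ m
      differs = vec-≢ ν≢γ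
    cases : Dec (Any (StrictlyBelow w γ) level1) → ∃[ μ ] (μ ∈ minimals w × Below μ γ)
    cases (no none)  = γ , ∈-minimals {w} (out , none) , (λ m → ≤-refl) , refl
    cases (yes some) = proj₁ below , proj₁ (proj₂ below) ,
                       Below-trans {proj₁ below} {ν} {γ} (proj₂ (proj₂ below)) (proj₁ (proj₂ ν-below))
      where
      ν : Vec ℤ n
      ν = proj₁ (find some)
      ν-below : StrictlyBelow w γ ν
      ν-below = proj₂ (proj₂ (find some))
      below : ∃[ μ ] (μ ∈ minimals w × Below μ ν)
      below = minimal-below w h ν (proj₁ ν-below) (shorter (proj₁ (proj₂ ν-below)) (proj₂ (proj₂ ν-below)))

  -- For w ∈ W⁰ the set N(w) is a lower set, so I(Γ_w) is exactly its complement in Δ(1), and the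
  -- representative of Γ_w has the same inversions as w.
  wt-rep-Γ : ∀ {w} → W0 w → wt (rep (minAntichain w)) ≡ wt w
  wt-rep-Γ {w} w0 = wt-cong {rep (minAntichain w)} {w} fwd bwd
    where
    fwd : ∀ γ → Inv (rep (minAntichain w)) γ → Inv w γ
    fwd γ inv = decidable-stable (Inv? w γ) λ ¬inv →
      proj₂ co (proj₁ co , minimal-below w (suc ∣ height γ ∣) γ (proj₁ co , ¬inv) (<+suc∣∣ (height γ)))
      where
      co : Co (minAntichain w) γ
      co = Inv⇒Co (minAntichain w) γ inv
    bwd : ∀ γ → Inv w γ → Inv (rep (minAntichain w)) γ
    bwd γ inv = Co⇒Inv (minAntichain w) γ (Inv⇒Level1 {w} {γ} w0 inv , notUp)
      where
      notUp : ¬ Up (minAntichain w) γ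
      notUp (_ , μ , μ∈ , μ≼γ) with ∈-minimals⁻ {w} μ∈
      ... | (lμ , ¬inv) , _ = ¬inv (Inv-lower {w} {μ} {γ} w0 inv lμ μ≼γ)

  weightOf-iso : IsOrderIso C i weightOf
  weightOf-iso = record
    { respects   = λ Γ Γ′ same → wt-cong {rep Γ} {rep Γ′}
        (Inv-rep-antitone Γ′ Γ (Up-mono Γ′ Γ (proj₂ ∘ same))) (Inv-rep-antitone Γ Γ′ (Up-mono Γ Γ′ (proj₁ ∘ same)))
    ; injective  = λ Γ Γ′ e → let
        sub = reflects Γ Γ′ (subst (wt (rep Γ) ⊑_) e (⊑-refl (wt (rep Γ))))
        sup = reflects Γ′ Γ (subst (_⊑ wt (rep Γ)) e (⊑-refl (wt (rep Γ))))
        in λ β → Up-⊆⇒∈ Γ Γ′ sub sup β , Up-⊆⇒∈ Γ′ Γ sup sub β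
    ; surjective = λ { (v , u , v≡) → let (w , w0 , e) = W0-representative u in
        minAntichain w , trans (wt-rep-Γ {w} w0) (trans e (sym v≡)) }
    ; monotone   = λ Γ Γ′ sub → wt-antitone {rep Γ} {rep Γ′} (rep-W0 Γ) (rep-W0 Γ′) (Inv-rep-antitone Γ Γ′ sub)
    ; reflecting = reflects
    }
    where
    Up-mono : ∀ Γ Γ′ → (∀ β → β ∈ proj₁ Γ → β ∈ proj₁ Γ′) → ∀ β → Up Γ β → Up Γ′ β
    Up-mono Γ Γ′ sub β (lβ , γ , γ∈Γ , γ≼β) = lβ , γ , sub γ γ∈Γ , γ≼β

theorem3p7 : (n : ℕ) (C : Cartan n) → IsSimpleCartan C →
    (i : Fin n) (θ : Vec ℤ n) → IsHighestRoot C θ → lookup θ i ≡ 1ℤ →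
    Σ (AN C i → P C i) (λ f →
    IsOrderIso C i f ×
    (∀ (w : Word C) → InW0 C i w →
    ∃[ Γ ] (IsΓ C i w Γ × proj₁ (f Γ) ≡ actCo C w (φ∨ C i))))
theorem3p7 n C cartan i θ highest θᵢ≡1 =
  weightOf , weightOf-iso , λ w w0 → minAntichain w , minAntichain-isΓ w , wt-rep-Γ {w} w0
  where open Abelian C cartan i θ highest θᵢ≡1
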